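{- Let $p>3$ be a prime and let $t\in\mathbb{Z}_p$ with $4t\not\equiv \pm 5\pmod p$. Then $$\sum_{k=0}^{(p-1)/2}\binom{2k}k^2\binom{3k}k\Big(\frac{1-t^2}{108}\Big)^k \equiv \Big(\frac{5-4t}p\Big)\sum_{k=0}^{\lfloor p/6\rfloor}\binom{2k}k\binom{3k}k\binom{6k}{3k} \Big(\frac{(t-1)(t+1)^3}{432(4t-5)^3}\Big)^k \equiv \Big(\frac{5+4t}p\Big)\sum_{k=0}^{\lfloor p/6\rfloor}\binom{2k}k\binom{3k}k\binom{6k}{3k} \Big(\frac{(t+1)(1-t)^3}{432(4t+5)^3}\Big)^k \pmod p.$$
   Context: For a prime $p$, $\mathbb{Z}_p$ denotes the set of rational numbers whose denominator is not divisible by $p$; congruences modulo $p$ are taken in $\mathbb{Z}_p$. For $a\in\mathbb{Z}_p$, $\big(\frac ap\big)$ is the Legendre symbol of $a$ (i.e. of any integer congruent to $a$ modulo $p$). $\lfloor x\rfloor$ is the greatest integer not exceeding $x$. -}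

module Defs where

open import Data.Nat as ℕ using (ℕ; zero; suc)
open import Data.Nat.Combinatorics using (_C_)
open import Data.Integer as ℤ using (ℤ; +_; -[1+_]; +[1+_])
open import Data.Integer.Divisibility using () renaming (_∣_ to _∣ℤ_)
open import Data.Integer.DivMod using (_%ℕ_)
open import Data.Rational as ℚ using (ℚ; mkℚ; 0ℚ; 1ℚ; _+_; _*_; _-_; 1/_)
open import Data.List using (List; map; upTo; foldr)
open import Data.Bool.ListAction using (any)
open import Data.Bool using (Bool; if_then_else_)
open import Data.Nat using (_≡ᵇ_)
open import Data.Nat.Divisibility using () renaming (_∣_ to _∣ℕ_)
open import Relation.Nullary using (¬_)

ℕ→ℚ : ℕ → ℚ
ℕ→ℚ n = (+ n) ℚ./ 1

_^_ : ℚ → ℕ → ℚ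
q ^ zero  = 1ℚ
q ^ suc n = q * (q ^ n)

-- multiplicative inverse of a rational; only used for nonzero arguments
-- (defined as 0 at 0 to make it total)
inv : ℚ → ℚ
inv q@(mkℚ (+ zero) _ _) = 0ℚ
inv q@(mkℚ +[1+ n ] _ _) = 1/ q
inv q@(mkℚ -[1+ n ] _ _) = 1/ q

sumTo : ℕ → (ℕ → ℚ) → ℚ
sumTo N f = foldr _+_ 0ℚ (map f (upTo (suc N)))

InZp : ℕ → ℚ → Set
InZp p q = ¬ (p ∣ℕ ℚ.denominatorℕ q)

infix 4 _≡_[mod_]
_≡_[mod_] : ℚ → ℚ → ℕ → Set
a ≡ b [mod p ] = (+ p) ∣ℤ ℚ.numerator (a - b)

legendre : (p : ℕ) → .{{_ : ℕ.NonZero p}} → ℤ → ℤ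
legendre p n =
  if (n %ℕ p) ≡ᵇ 0 then + 0
  else if any (λ x → ((+ x ℤ.* + x) ℤ.- n) %ℕ p ≡ᵇ 0) (upTo p) then + 1
  else ℤ.- (+ 1)

ℤ→ℚ : ℤ → ℚ
ℤ→ℚ n = n ℚ./ 1

S₁ : ℕ → ℚ → ℚ
S₁ p t = sumTo ((p ℕ.∸ 1) ℕ./ 2) λ k →
  ℕ→ℚ (((2 ℕ.* k) C k) ℕ.* ((2 ℕ.* k) C k) ℕ.* ((3 ℕ.* k) C k))
    * (((1ℚ - t * t) * inv (ℕ→ℚ 108)) ^ k)

S₂ : ℕ → ℚ → ℚ
S₂ p t = sumTo (p ℕ./ 6) λ k →
  ℕ→ℚ (((2 ℕ.* k) C k) ℕ.* ((3 ℕ.* k) C k) ℕ.* ((6 ℕ.* k) C (3 ℕ.* k)))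
    * (((t - 1ℚ) * ((t + 1ℚ) ^ 3)
        * inv (ℕ→ℚ 432 * ((ℕ→ℚ 4 * t - ℕ→ℚ 5) ^ 3))) ^ k)

S₃ : ℕ → ℚ → ℚ
S₃ p t = sumTo (p ℕ./ 6) λ k →
  ℕ→ℚ (((2 ℕ.* k) C k) ℕ.* ((3 ℕ.* k) C k) ℕ.* ((6 ℕ.* k) C (3 ℕ.* k)))
    * (((t + 1ℚ) * ((1ℚ - t) ^ 3)
        * inv (ℕ→ℚ 432 * ((ℕ→ℚ 4 * t + ℕ→ℚ 5) ^ 3))) ^ k)

{-# OPTIONS --safe #-}
-- S₃ p t is S₂ p (−t) and S₁ p is even, so it suffices to compare S₁ p t with S₂ p t. Put s = 1 − t and
-- h = (p − 1)/2. By Euler's criterion the Legendre symbol is (5 − 4t)ʰ = (1 + 4s)ʰ, so both sides are values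
-- modulo p of polynomials of degree less than p in s, with constant term 1:
--   Σ αₖ (s(2 − s))ᵏ   and   Σ βₖ (s(2 − s)³)ᵏ (1 + 4s)ʰ⁻³ᵏ.
-- As 2h = −1 modulo p, both are annihilated by the third-order operator L satisfied by the square of a
-- Legendre function of degree −1/3: L maps each summand to a difference of consecutive terms, and the sums
-- terminate because p divides the last factor. The coefficient recurrence of L has leading coefficient
-- 36 n³, which is invertible for 0 < n < p, so the two polynomials agree.
module Submission where

open import Defs hiding (_^_)
open import Defs using () renaming (_^_ to _^ℚ_)
open import Algebra.Bundles using (CommutativeRing)
import Algebra.Solver.Ring
open import Algebra.Solver.Ring.AlmostCommutativeRing
  using (fromCommutativeRing; _-Raw-AlmostCommutative⟶_)
open import Data.Bool using (true; false; T)
open import Data.Bool.ListAction using (any)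
open import Data.Empty using (⊥; ⊥-elim)
import Data.Fin as Fin
import Data.Fin.Properties as Fin
open import Data.Integer as ℤ using (ℤ; +_; -[1+_]; +[1+_])
import Data.Integer.Divisibility.Signed as ℤ
import Data.Integer.DivMod as ℤ
import Data.Integer.Properties as ℤ
import Data.Integer.Solver as ℤ
open import Data.List as List using (applyUpTo; upTo)
open import Data.List.Membership.Propositional using (lose)
open import Data.List.Membership.Propositional.Properties using (∈-upTo⁺)
import Data.List.Properties as List
import Data.List.Relation.Unary.Any as Any
import Data.List.Relation.Unary.Any.Properties as Any
open import Data.Maybe using (Maybe; just; nothing)
open import Data.Nat as ℕ using (ℕ; zero; suc; _<_; NonZero; _!)
open import Data.Nat.Combinatorics using (_C_; nCn≡1; k![n∸k]!∣n!; nCk≡n!/k![n-k]!)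
import Data.Nat.Divisibility as ℕ
import Data.Nat.DivMod as ℕ
open import Data.Nat.Primality using (Prime; euclidsLemma; prime⇒irreducible; prime⇒nonTrivial)
import Data.Nat.Properties as ℕ
import Data.Nat.Solver as ℕ
open import Data.Product using (_×_; _,_; proj₁; proj₂; ∃)
open import Data.Rational as ℚ using (ℚ; mkℚ; 0ℚ; 1ℚ; toℚᵘ)
import Data.Rational.Properties as ℚ
import Data.Rational.Solver as ℚ
open import Data.Rational.Unnormalised as ℚᵘ using (mkℚᵘ; *≡*)
import Data.Rational.Unnormalised.Properties as ℚᵘ
open import Data.Sum using (_⊎_; inj₁; inj₂)
open import Data.Unit using (tt)
open import Data.Vec using (Vec; []; _∷_; replicate)
open import Function using (_∘_; case_of_)
open import Level using (_⊔_)
open import Relation.Nullary using (¬_; yes; no; recompute)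
open import Relation.Binary.PropositionalEquality as ≡ using (_≡_; _≢_)
import Relation.Binary.Reasoning.Setoid

-- Formal power series

-- Over the rationals the identity is classical: 3F2(1/3,1/2,2/3;1,1;s(2-s)) is the square of the
-- Legendre function of degree -1/3 at 1-s, by Clausen's formula and a quadratic transformation, and
-- it also equals (1+4s)^(-1/2) times 3F2(1/6,1/2,5/6;1,1;4s(2-s)³/(1+4s)³). Truncation does not
-- commute with these substitutions, so the series identity cannot simply be reduced modulo p; the
-- differential equation is applied to the truncated sums themselves. The exponent -1/2-3k is
-- replaced by h-3k, which is congruent to it and nonnegative because 3⌊p/6⌋ ≤ h. This makes the
-- second sum a polynomial, and both sums have degree at most 2h = p-1, just below the index p at
-- which the coefficient recurrence breaks down. A congruence at a single residue cannot be
-- differentiated. The identity is therefore proved for formal power series with the derivation θ =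
-- s d/ds, and evaluation at a residue is a separate relation. Division is avoided throughout:
-- logarithmic derivatives are kept as fractions, and `L` is multiplied by their common denominator.

IntegersTo : ∀ {c ℓ} → CommutativeRing c ℓ → Set _
IntegersTo R = ℤ.+-*-rawRing -Raw-AlmostCommutative⟶ fromCommutativeRing R

module IntegerAlgebra {c ℓ} (R : CommutativeRing c ℓ) (int : IntegersTo R) where
  open CommutativeRing R public
  open import Algebra.Properties.Semiring.Exp semiring public using (_^_; ^-congˡ; ^-homo-*; ^-assocʳ)
  open import Algebra.Properties.Ring ring public
    using (x∙y⁻¹≈ε⇒x≈y; x≈y⇒x∙y⁻¹≈ε)
  module Reasoning = Relation.Binary.Reasoning.Setoid setoid
  open _-Raw-AlmostCommutative⟶_ int public
    using () renaming (⟦_⟧ to ι; +-homo to ι-+; *-homo to ι-*; 0-homo to ι-0; 1-homo to ι-1; -‿homo to ι-neg)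

  ι-^ : ∀ m k → ι (m ℤ.^ k) ≈ ι m ^ k
  ι-^ m zero    = ι-1
  ι-^ m (suc k) = trans (ι-* _ _) (*-congˡ (ι-^ m k))

  ι-≡ : ∀ {a b} → a ≡ b → ι a ≈ ι b
  ι-≡ ≡.refl = refl

  private
    ι-≟ : ∀ a b → Maybe (ι a ≈ ι b)
    ι-≟ a b with a ℤ.≟ b
    ... | yes a≡b = just (ι-≡ a≡b)
    ... | no  _   = nothing

  open Algebra.Solver.Ring ℤ.+-*-rawRing (fromCommutativeRing R) int ι-≟ public
    using (Polynomial; con; solve; _:=_; _:+_; _:*_; _:-_; :-_)

  -- The upper limit n is included, as in sumTo.
  ∑ : ℕ → (ℕ → Carrier) → Carrier
  ∑ zero    f = f 0
  ∑ (suc n) f = ∑ n f + f (suc n)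

  ∑-cong : ∀ n {f g} → (∀ k → k ℕ.≤ n → f k ≈ g k) → ∑ n f ≈ ∑ n g
  ∑-cong zero    f≈g = f≈g 0 ℕ.z≤n
  ∑-cong (suc n) f≈g =
    +-cong (∑-cong n λ k k≤n → f≈g k (ℕ.m≤n⇒m≤1+n k≤n)) (f≈g (suc n) ℕ.≤-refl)

  ∑-distribˡ : ∀ n x f → x * ∑ n f ≈ ∑ n (λ k → x * f k)
  ∑-distribˡ zero    x f = refl
  ∑-distribˡ (suc n) x f = trans (distribˡ x _ _) (+-congʳ (∑-distribˡ n x f))

  ∑-head : ∀ n f → ∑ (suc n) f ≈ f 0 + ∑ n (λ k → f (suc k))
  ∑-head zero    f = refl
  ∑-head (suc n) f = trans (+-congʳ (∑-head n f)) (+-assoc _ _ _)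

  ^-distrib-* : ∀ x y n → (x * y) ^ n ≈ x ^ n * y ^ n
  ^-distrib-* x y zero    = sym (*-identityˡ 1#)
  ^-distrib-* x y (suc n) = trans (*-congˡ (^-distrib-* x y n))
    (solve 4 (λ x y a b → (x :* y) :* (a :* b) := (x :* a) :* (y :* b)) refl x y (x ^ n) (y ^ n))

  1#^n≈1# : ∀ n → 1# ^ n ≈ 1#
  1#^n≈1# zero    = refl
  1#^n≈1# (suc n) = trans (*-identityˡ _) (1#^n≈1# n)

module PowerSeries {c ℓ} (K : CommutativeRing c ℓ) (int : IntegersTo K) where
  private module K = IntegerAlgebra K int
  open K using (Carrier)
  open K.Reasoning

  Series : Set c
  Series = ℕ → Carrier

  infix 4 _≈_
  record _≈_ (f g : Series) : Set ℓ where
    constructor coefficientwise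
    field coefficient : ∀ n → f n K.≈ g n
  open _≈_ public

  tail : Series → Series
  tail f n = f (suc n)

  const : Carrier → Series
  const a zero    = a
  const a (suc n) = K.0#

  X : Series
  X zero    = K.0#
  X (suc n) = const K.1# n

  _+_ _*_ : Series → Series → Series
  (f + g) n = f n K.+ g n
  (f * g) zero    = f 0 K.* g 0
  (f * g) (suc n) = f 0 K.* g (suc n) K.+ (tail f * g) n
  infixl 6 _+_
  infixl 7 _*_

  -_ : Series → Series
  (- f) n = K.- f n

  θ : Series → Series
  θ f n = K.ι (+ n) K.* f n

  private
    infix 4 _≗_
    _≗_ : Series → Series → Set ℓ
    f ≗ g = ∀ n → f n K.≈ g n

    *-cong : ∀ {f f′ g g′} → f ≗ f′ → g ≗ g′ → f * g ≗ f′ * g′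
    *-cong p q zero    = K.*-cong (p 0) (q 0)
    *-cong p q (suc n) = K.+-cong (K.*-cong (p 0) (q (suc n))) (*-cong (λ k → p (suc k)) q n)

    -- The product is defined by peeling coefficients off the left factor. Peeling off the right one
    -- as well makes the definition symmetric, which is what commutativity needs.
    *-sucʳ : ∀ f g n → (f * g) (suc n) K.≈ f (suc n) K.* g 0 K.+ (f * tail g) n
    *-sucʳ f g zero    = K.+-comm _ _
    *-sucʳ f g (suc n) = begin
      f 0 K.* g (2 ℕ.+ n) K.+ (tail f * g) (suc n)
        ≈⟨ K.+-congˡ (*-sucʳ (tail f) g n) ⟩
      f 0 K.* g (2 ℕ.+ n) K.+ (f (2 ℕ.+ n) K.* g 0 K.+ (tail f * tail g) n)
        ≈⟨ K.solve 3 (λ a b c → a K.:+ (b K.:+ c) K.:= b K.:+ (a K.:+ c)) K.refl _ _ _ ⟩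
      f (2 ℕ.+ n) K.* g 0 K.+ (f 0 K.* g (2 ℕ.+ n) K.+ (tail f * tail g) n) ∎

    *-comm : ∀ f g → f * g ≗ g * f
    *-comm f g zero    = K.*-comm _ _
    *-comm f g (suc n) = begin
      f 0 K.* g (suc n) K.+ (tail f * g) n ≈⟨ K.+-cong (K.*-comm _ _) (*-comm (tail f) g n) ⟩
      g (suc n) K.* f 0 K.+ (g * tail f) n ≈⟨ *-sucʳ g f n ⟨
      (g * f) (suc n)                      ∎

    *-distribʳ : ∀ f g h → (g + h) * f ≗ g * f + h * f
    *-distribʳ f g h zero    = K.distribʳ _ _ _
    *-distribʳ f g h (suc n) = begin
      (g 0 K.+ h 0) K.* f (suc n) K.+ ((tail g + tail h) * f) n
        ≈⟨ K.+-congˡ (*-distribʳ f (tail g) (tail h) n) ⟩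
      (g 0 K.+ h 0) K.* f (suc n) K.+ ((tail g * f) n K.+ (tail h * f) n)
        ≈⟨ K.solve 5 (λ a b c d e → (a K.:+ b) K.:* c K.:+ (d K.:+ e)
                         K.:= (a K.:* c K.:+ d) K.:+ (b K.:* c K.:+ e)) K.refl _ _ _ _ _ ⟩
      (g * f + h * f) (suc n) ∎

    scale-* : ∀ a f g → (λ n → a K.* f n) * g ≗ (λ n → a K.* (f * g) n)
    scale-* a f g zero    = K.*-assoc _ _ _
    scale-* a f g (suc n) = begin
      (a K.* f 0) K.* g (suc n) K.+ ((λ n → a K.* tail f n) * g) n
        ≈⟨ K.+-congˡ (scale-* a (tail f) g n) ⟩
      (a K.* f 0) K.* g (suc n) K.+ a K.* (tail f * g) n
        ≈⟨ K.solve 4 (λ a b c d → (a K.:* b) K.:* c K.:+ a K.:* d K.:= a K.:* (b K.:* c K.:+ d)) K.refl _ _ _ _ ⟩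
      a K.* (f * g) (suc n) ∎

    *-assoc : ∀ f g h → (f * g) * h ≗ f * (g * h)
    *-assoc f g h zero    = K.*-assoc _ _ _
    *-assoc f g h (suc n) = begin
      (f 0 K.* g 0) K.* h (suc n) K.+ (((λ k → f 0 K.* tail g k) + tail f * g) * h) n
        ≈⟨ K.+-congˡ (*-distribʳ h (λ k → f 0 K.* tail g k) (tail f * g) n) ⟩
      (f 0 K.* g 0) K.* h (suc n) K.+ (((λ k → f 0 K.* tail g k) * h) n K.+ ((tail f * g) * h) n)
        ≈⟨ K.+-congˡ (K.+-cong (scale-* (f 0) (tail g) h n) (*-assoc (tail f) g h n)) ⟩
      (f 0 K.* g 0) K.* h (suc n) K.+ (f 0 K.* (tail g * h) n K.+ (tail f * (g * h)) n)
        ≈⟨ K.solve 5 (λ a b c d e → (a K.:* b) K.:* c K.:+ (a K.:* d K.:+ e)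
                         K.:= a K.:* (b K.:* c K.:+ d) K.:+ e) K.refl _ _ _ _ _ ⟩
      (f * (g * h)) (suc n) ∎

    zero-* : ∀ f g → (∀ n → f n K.≈ K.0#) → ∀ n → (f * g) n K.≈ K.0#
    zero-* f g f≈0 zero    = K.trans (K.*-congʳ (f≈0 0)) (K.zeroˡ _)
    zero-* f g f≈0 (suc n) = K.trans
      (K.+-cong (K.trans (K.*-congʳ (f≈0 0)) (K.zeroˡ _)) (zero-* (tail f) g (λ k → f≈0 (suc k)) n))
      (K.+-identityˡ _)

    const-* : ∀ a f → const a * f ≗ (λ n → a K.* f n)
    const-* a f zero    = K.refl
    const-* a f (suc n) = K.trans (K.+-congˡ (zero-* _ f (λ _ → K.refl) n)) (K.+-identityʳ _)

    *-identityˡ : ∀ f → const K.1# * f ≗ f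
    *-identityˡ f n = K.trans (const-* K.1# f n) (K.*-identityˡ _)

    -- `θ` does not commute with `tail`: the weight drops by one, so `tail (θ f)` exceeds
    -- `θ (tail f)` by `tail f`. This surplus accounts for the 1 in ι (n + 1) = 1 + ι n.
    θ-* : ∀ f g → θ (f * g) ≗ θ f * g + f * θ g
    θ-* f g zero    = begin
      K.ι (+ 0) K.* (f 0 K.* g 0)
        ≈⟨ K.solve 2 (λ a b → K.con (+ 0) K.:* (a K.:* b) K.:=
             (K.con (+ 0) K.:* a) K.:* b K.:+ a K.:* (K.con (+ 0) K.:* b)) K.refl _ _ ⟩
      (θ f * g + f * θ g) 0 ∎
    θ-* f g (suc n) = begin
      K.ι (+ suc n) K.* (f 0 K.* g (suc n) K.+ (tail f * g) n)
        ≈⟨ K.*-congʳ (K.ι-+ (+ 1) (+ n)) ⟩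
      (K.ι (+ 1) K.+ K.ι (+ n)) K.* (f 0 K.* g (suc n) K.+ (tail f * g) n)
        ≈⟨ K.solve 4 (λ m a b c → (K.con (+ 1) K.:+ m) K.:* (a K.:* b K.:+ c) K.:=
             a K.:* ((K.con (+ 1) K.:+ m) K.:* b) K.:+ (c K.:+ m K.:* c)) K.refl _ _ _ _ ⟩
      f 0 K.* ((K.ι (+ 1) K.+ K.ι (+ n)) K.* g (suc n)) K.+ ((tail f * g) n K.+ θ (tail f * g) n)
        ≈⟨ K.+-cong (K.*-congˡ (K.*-congʳ (K.sym (K.ι-+ (+ 1) (+ n))))) (K.+-congˡ (θ-* (tail f) g n)) ⟩
      f 0 K.* θ g (suc n) K.+ ((tail f * g) n K.+ ((θ (tail f) * g) n K.+ (tail f * θ g) n))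
        ≈⟨ K.solve 6 (λ z a b x y u → a K.:+ (x K.:+ (y K.:+ u)) K.:=
             (K.con (+ 0) K.:* z) K.:* b K.:+ (x K.:+ y) K.:+ (a K.:+ u))
             K.refl (f 0) _ (g (suc n)) _ _ _ ⟩
      (K.ι (+ 0) K.* f 0) K.* g (suc n) K.+ ((tail f * g) n K.+ (θ (tail f) * g) n)
        K.+ (f 0 K.* θ g (suc n) K.+ (tail f * θ g) n)
        ≈⟨ K.+-congʳ (K.+-congˡ (*-distribʳ g (tail f) (θ (tail f)) n)) ⟨
      (K.ι (+ 0) K.* f 0) K.* g (suc n) K.+ ((tail f + θ (tail f)) * g) n
        K.+ (f 0 K.* θ g (suc n) K.+ (tail f * θ g) n)
        ≈⟨ K.+-congʳ (K.+-congˡ (*-cong tail-θ (λ _ → K.refl) n)) ⟨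
      (θ f * g + f * θ g) (suc n) ∎
      where
      tail-θ : tail (θ f) ≗ tail f + θ (tail f)
      tail-θ k = K.trans (K.*-congʳ (K.ι-+ (+ 1) (+ k)))
        (K.solve 2 (λ m x → (K.con (+ 1) K.:+ m) K.:* x K.:= x K.:+ m K.:* x) K.refl _ _)

  commutativeRing : CommutativeRing c ℓ
  commutativeRing = record
    { Carrier = Series ; _≈_ = _≈_ ; _+_ = _+_ ; _*_ = _*_ ; -_ = -_
    ; 0# = λ _ → K.0# ; 1# = const K.1#
    ; isCommutativeRing = record
      { isRing = record
        { +-isAbelianGroup = record
          { isGroup = record
            { isMonoid = record
              { isSemigroup = record
                { isMagma = record
                  { isEquivalence = record
                    { refl  = coefficientwise λ _ → K.refl
                    ; sym   = λ p → coefficientwise λ n → K.sym (coefficient p n)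
                    ; trans = λ p q → coefficientwise λ n → K.trans (coefficient p n) (coefficient q n)
                    }
                  ; ∙-cong = λ p q → coefficientwise λ n → K.+-cong (coefficient p n) (coefficient q n)
                  }
                ; assoc = λ f g h → coefficientwise λ n → K.+-assoc _ _ _
                }
              ; identity = (λ f → coefficientwise λ n → K.+-identityˡ _)
                         , (λ f → coefficientwise λ n → K.+-identityʳ _)
              }
            ; inverse = (λ f → coefficientwise λ n → K.-‿inverseˡ _)
                      , (λ f → coefficientwise λ n → K.-‿inverseʳ _)
            ; ⁻¹-cong = λ p → coefficientwise λ n → K.-‿cong (coefficient p n)
            }
          ; comm = λ f g → coefficientwise λ n → K.+-comm _ _
          }
        ; *-cong = λ p q → coefficientwise (*-cong (coefficient p) (coefficient q))
        ; *-assoc = λ f g h → coefficientwise (*-assoc f g h)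
        ; *-identity = (λ f → coefficientwise (*-identityˡ f))
                     , (λ f → coefficientwise λ n → K.trans (*-comm f _ n) (*-identityˡ f n))
        ; distrib = (λ f g h → coefficientwise λ n → K.trans (*-comm f (g + h) n)
                      (K.trans (*-distribʳ f g h n) (K.+-cong (*-comm g f n) (*-comm h f n))))
                  , (λ f g h → coefficientwise (*-distribʳ f g h))
        }
      ; *-comm = λ f g → coefficientwise (*-comm f g)
      }
    }

  const-cong : ∀ {a b} → a K.≈ b → const a ≈ const b
  const-cong a≈b = coefficientwise λ { zero → a≈b ; (suc n) → K.refl }

  const-+ : ∀ a b → const (a K.+ b) ≈ const a + const b
  const-+ a b = coefficientwise λ { zero → K.refl ; (suc n) → K.sym (K.+-identityˡ _) }

  const-scale : ∀ a b → const (a K.* b) ≈ const a * const b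
  const-scale a b = coefficientwise
    λ { zero → K.refl ; (suc n) → K.sym (K.trans (const-* a (const b) (suc n)) (K.zeroʳ a)) }

  integers : IntegersTo commutativeRing
  integers = record
    { ⟦_⟧    = λ n → const (K.ι n)
    ; +-homo = λ m n → trans (const-cong (K.ι-+ m n)) (const-+ _ _)
    ; *-homo = λ m n → trans (const-cong (K.ι-* m n)) (const-scale _ _)
    ; -‿homo = λ n → coefficientwise
        λ { zero → -‿homo n ; (suc m) → K.sym -0#≈0# }
    ; 0-homo = coefficientwise λ { zero → 0-homo ; (suc n) → K.refl }
    ; 1-homo = const-cong 1-homo
    }
    where
    open CommutativeRing commutativeRing using (trans)
    open _-Raw-AlmostCommutative⟶_ int using (-‿homo; 0-homo; 1-homo)
    open import Algebra.Properties.Ring K.ring using (-0#≈0#)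

  private module S = IntegerAlgebra commutativeRing integers

  θ-cong : ∀ {f g} → f ≈ g → θ f ≈ θ g
  θ-cong p = coefficientwise λ n → K.*-congˡ (coefficient p n)

  θ-+ : ∀ f g → θ (f + g) ≈ θ f + θ g
  θ-+ f g = coefficientwise λ n → K.distribˡ _ _ _

  leibniz : ∀ f g → θ (f * g) ≈ θ f * g + f * θ g
  leibniz f g = coefficientwise (θ-* f g)

  θ-ι : ∀ n → θ (S.ι n) ≈ S.0#
  θ-ι n = coefficientwise λ { zero → K.trans (K.*-congʳ K.ι-0) (K.zeroˡ _) ; (suc k) → K.zeroʳ _ }

  θ-X : θ X ≈ X
  θ-X = coefficientwise λ { zero → K.zeroʳ _
    ; (suc zero)    → K.trans (K.*-congʳ K.ι-1) (K.*-identityˡ _)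
    ; (suc (suc n)) → K.zeroʳ _ }

  infix 4 X^_∣_
  X^_∣_ : ℕ → Series → Set ℓ
  X^ n ∣ f = ∀ k → k ℕ.< n → f k K.≈ K.0#

  -- Only the constant term of `f` meets the lowest coefficient of `g`. Thus the lowest coefficient
  -- of a differential expression depends only on the constant terms of its coefficient series.
  *-coefficient : ∀ {n} f g → X^ n ∣ g → (f * g) n K.≈ f 0 K.* g n
  *-coefficient {n} f g n∣g = K.trans (*-comm f g n)
    (K.trans (go n g n∣g) (K.*-comm _ _))
    where
    go : ∀ n g → X^ n ∣ g → (g * f) n K.≈ g n K.* f 0
    go zero    g _   = K.refl
    go (suc n) g n∣g = K.trans
      (K.+-cong (K.trans (K.*-congʳ (n∣g 0 ℕ.z<s)) (K.zeroˡ _))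
                (go n (tail g) λ k k<n → n∣g (suc k) (ℕ.s<s k<n)))
      (K.+-identityˡ _)

  X^∣-θ : ∀ {n f} → X^ n ∣ f → X^ n ∣ θ f
  X^∣-θ n∣f k k<n = K.trans (K.*-congˡ (n∣f k k<n)) (K.zeroʳ _)

  X^∣-+ : ∀ {n f g} → X^ n ∣ f → X^ n ∣ g → X^ n ∣ f + g
  X^∣-+ n∣f n∣g k k<n = K.trans (K.+-cong (n∣f k k<n) (n∣g k k<n)) (K.+-identityˡ _)

  X^∣-* : ∀ {n} f {g} → X^ n ∣ g → X^ n ∣ f * g
  X^∣-* f {g} n∣g k k<n = K.trans (*-coefficient f g λ j j<k → n∣g j (ℕ.<-trans j<k k<n))
    (K.trans (K.*-congˡ (n∣g k k<n)) (K.zeroʳ _))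

  -- Polynomials among the series, and their values

  module Evaluation (x : Carrier) where

    -- Poly d f v: the series f is a polynomial of degree at most d, with value v at x.
    data Poly : ℕ → Series → Carrier → Set (c ⊔ ℓ) where
      constant : ∀ {d f v} a → f ≈ const a → v K.≈ a → Poly d f v
      horner   : ∀ {d f v} a {g w} → Poly d g w → f ≈ const a + X * g → v K.≈ a K.+ x K.* w →
                 Poly (suc d) f v

    resp : ∀ {d f g v w} → f ≈ g → v K.≈ w → Poly d f v → Poly d g w
    resp f≈g v≈w (constant a p q) = constant a (S.trans (S.sym f≈g) p) (K.trans (K.sym v≈w) q)
    resp f≈g v≈w (horner a P p q) = horner a P (S.trans (S.sym f≈g) p) (K.trans (K.sym v≈w) q)

    weaken : ∀ {d e f v} → d ℕ.≤ e → Poly d f v → Poly e f v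
    weaken d≤e         (constant a p q) = constant a p q
    weaken (ℕ.s≤s d≤e) (horner a P p q) = horner a (weaken d≤e P) p q

    add : ∀ {d f g v w} → Poly d f v → Poly d g w → Poly d (f + g) (v K.+ w)
    add (constant a p q) (constant b p′ q′) =
      constant (a K.+ b) (S.trans (S.+-cong p p′) (S.sym (const-+ a b))) (K.+-cong q q′)
    add (constant a p q) (horner b P p′ q′) = horner (a K.+ b) P
      (S.trans (S.+-cong p p′) (S.trans (S.sym (S.+-assoc _ _ _)) (S.+-congʳ (S.sym (const-+ a b)))))
      (K.trans (K.+-cong q q′) (K.sym (K.+-assoc _ _ _)))
    add (horner a P p q) (constant b p′ q′) = horner (a K.+ b) P
      (S.trans (S.+-cong p p′) (S.trans
        (S.solve 3 (λ a b c → (a S.:+ b) S.:+ c S.:= (a S.:+ c) S.:+ b) S.refl _ _ _)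
        (S.+-congʳ (S.sym (const-+ a b)))))
      (K.trans (K.+-cong q q′)
        (K.solve 3 (λ a b c → (a K.:+ b) K.:+ c K.:= (a K.:+ c) K.:+ b) K.refl _ _ _))
    add (horner a P p q) (horner b Q p′ q′) = horner (a K.+ b) (add P Q)
      (S.trans (S.+-cong p p′) (S.trans
        (S.solve 5 (λ a b c d x → (a S.:+ x S.:* b) S.:+ (c S.:+ x S.:* d)
                      S.:= (a S.:+ c) S.:+ x S.:* (b S.:+ d)) S.refl _ _ _ _ _)
        (S.+-congʳ (S.sym (const-+ a b)))))
      (K.trans (K.+-cong q q′)
        (K.solve 5 (λ a b c d x → (a K.:+ x K.:* b) K.:+ (c K.:+ x K.:* d)
                      K.:= (a K.:+ c) K.:+ x K.:* (b K.:+ d)) K.refl _ _ _ _ _))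

    scale : ∀ {d f v} a → Poly d f v → Poly d (const a * f) (a K.* v)
    scale a (constant b p q) =
      constant (a K.* b) (S.trans (S.*-congˡ p) (S.sym (const-scale a b))) (K.*-congˡ q)
    scale a (horner b P p q) = horner (a K.* b) (scale a P)
      (S.trans (S.*-congˡ p) (S.trans
        (S.solve 4 (λ a b x g → a S.:* (b S.:+ x S.:* g) S.:= a S.:* b S.:+ x S.:* (a S.:* g)) S.refl _ _ _ _)
        (S.+-congʳ (S.sym (const-scale a b)))))
      (K.trans (K.*-congˡ q)
        (K.solve 4 (λ a b x g → a K.:* (b K.:+ x K.:* g) K.:= a K.:* b K.:+ x K.:* (a K.:* g)) K.refl _ _ _ _))

    mul : ∀ {d e f g v w} → Poly d f v → Poly e g w → Poly (d ℕ.+ e) (f * g) (v K.* w)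
    mul {d} (constant a p q) Q = resp (S.*-congʳ (S.sym p)) (K.*-congʳ (K.sym q))
      (weaken (ℕ.m≤n+m _ d) (scale a Q))
    mul {suc d} {e} (horner a P p q) Q = resp
      (S.trans (S.solve 4 (λ a x f g → a S.:* g S.:+ (S.con (+ 0) S.:+ x S.:* (f S.:* g))
                  S.:= (a S.:+ x S.:* f) S.:* g) S.refl _ _ _ _)
               (S.*-congʳ (S.sym p)))
      (K.trans (K.solve 4 (λ a x f g → a K.:* g K.:+ (K.con (+ 0) K.:+ x K.:* (f K.:* g))
                  K.:= (a K.:+ x K.:* f) K.:* g) K.refl _ _ _ _)
               (K.*-congʳ (K.sym q)))
      -- (a + X f) g = a g + X (f g); a zero constant term brings X (f g) into Horner form.
      (add (weaken (ℕ.m≤n+m e (suc d)) (scale a Q)) (horner (K.ι (+ 0)) (mul P Q) S.refl K.refl))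

    integer : ∀ {d} n → Poly d (S.ι n) (K.ι n)
    integer n = constant (K.ι n) S.refl K.refl

    variable-X : Poly 1 X x
    variable-X = horner K.0# (constant {d = 0} K.1# S.refl K.refl)
      (S.sym (S.trans (S.+-cong const-0 (S.*-identityʳ X)) (S.+-identityˡ X)))
      (K.sym (K.trans (K.+-identityˡ _) (K.*-identityʳ x)))
      where
      const-0 : const K.0# ≈ S.0#
      const-0 = coefficientwise λ { zero → K.refl ; (suc n) → K.refl }

    power : ∀ {d f v} n → Poly d f v → Poly (n ℕ.* d) (f S.^ n) (v K.^ n)
    power zero    P = constant K.1# S.refl K.refl
    power (suc n) P = mul P (power n P)

    sum : ∀ {d f v} n → (∀ k → k ℕ.≤ n → Poly d (f k) (v k)) → Poly d (S.∑ n f) (K.∑ n v)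
    sum zero    P = P 0 ℕ.z≤n
    sum (suc n) P = add (sum n λ k k≤n → P k (ℕ.m≤n⇒m≤1+n k≤n)) (P (suc n) ℕ.≤-refl)

    -- Degree at most d and divisibility by X^(d+1) leave only the zero polynomial. In Horner form
    -- the constant term is coefficient 0, and the remaining factor is divisible by one power of X
    -- less.
    vanishing : ∀ {d f v} → Poly d f v → X^ suc d ∣ f → v K.≈ K.0#
    vanishing (constant a p q) f≈0 =
      K.trans q (K.trans (K.sym (coefficient p 0)) (f≈0 0 ℕ.z<s))
    vanishing (horner a {g} P p q) f≈0 = K.trans q (K.trans
      (K.+-cong a≈0 (K.trans (K.*-congˡ (vanishing P g≈0)) (K.zeroʳ _))) (K.+-identityˡ _))
      where
      X*g : ∀ k → (X * g) (suc k) K.≈ g k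
      X*g k = K.trans (K.+-cong (K.zeroˡ _) (*-identityˡ g k)) (K.+-identityˡ _)
      a≈0 : a K.≈ K.0#
      a≈0 = K.trans (K.sym (K.trans (coefficient p 0) (K.trans (K.+-congˡ (K.zeroˡ _)) (K.+-identityʳ _))))
        (f≈0 0 ℕ.z<s)
      g≈0 : X^ suc _ ∣ g
      g≈0 k k<n = K.trans (K.sym (K.trans (coefficient p (suc k)) (K.trans (K.+-congˡ (X*g k)) (K.+-identityˡ _))))
        (f≈0 (suc k) (ℕ.s<s k<n))

-- Telescoping under the differential operator

record Derivation {c ℓ} (R : CommutativeRing c ℓ) (int : IntegersTo R) : Set (c ⊔ ℓ) where
  open IntegerAlgebra R int
  field
    θ       : Carrier → Carrier
    θ-cong  : ∀ {x y} → x ≈ y → θ x ≈ θ y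
    θ-+     : ∀ x y → θ (x + y) ≈ θ x + θ y
    leibniz : ∀ x y → θ (x * y) ≈ θ x * y + x * θ y
    θ-ι     : ∀ n → θ (ι n) ≈ 0#

affine : ℤ → ℤ → ℕ → ℤ
affine a b k = a ℤ.+ b ℤ.* + k

-- This is 18 (k+1/3)(k+1/2)(k+2/3), so `r₁ k` over 18 (k+1)³ is the term ratio of
-- 3F2(1/3,1/2,2/3;1,1).
r₁ : ℕ → ℤ
r₁ k = affine (+ 1) (+ 3) k ℤ.* (affine (+ 1) (+ 2) k ℤ.* affine (+ 2) (+ 3) k)

-- This is 72 (k+1/6)(k+1/2)(k+5/6). Over the same 18 (k+1)³ it gives 4 times the term ratio of
-- 3F2(1/6,1/2,5/6;1,1). The 4 is moved from the argument into the coefficients, which explains 432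
-- in place of 1728.
r₂ : ℕ → ℤ
r₂ k = affine (+ 1) (+ 6) k ℤ.* (affine (+ 1) (+ 2) k ℤ.* affine (+ 5) (+ 6) k)

-- The computations with `L` use only a derivation with θ s = s, so they hold in any differential
-- ring and reduce to polynomial identities for the ring solver. The instance of interest is the
-- ring of power series with s = X.
module LegendreSquare {c ℓ} (R : CommutativeRing c ℓ) (int : IntegersTo R) (derivation : Derivation R int)
  (s : CommutativeRing.Carrier R)
  (θs≈s : CommutativeRing._≈_ R (Derivation.θ derivation s) s) where
  open IntegerAlgebra R int
  open Derivation derivation
  open Reasoning

  θ-constant-* : ∀ {a} x → θ a ≈ 0# → θ (a * x) ≈ a * θ x
  θ-constant-* {a} x θa≈0 = begin
    θ (a * x)         ≈⟨ leibniz a x ⟩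
    θ a * x + a * θ x ≈⟨ +-congʳ (trans (*-congʳ θa≈0) (zeroˡ x)) ⟩
    0# + a * θ x      ≈⟨ +-identityˡ _ ⟩
    a * θ x           ∎

  -- The symmetric square of the operator of Legendre's equation of degree −1/3 in 1 − s.
  L : Carrier → Carrier
  L x = ι (+ 9) * ((ι (+ 2) - s) * (ι (+ 2) - s)) * θ (θ (θ x))
      + s * (ι (+ 27) * s - ι (+ 54)) * θ (θ x)
      + s * (ι (+ 26) * s - ι (+ 34)) * θ x
      + s * (ι (+ 8) * s - ι (+ 8)) * x

  L-+ : ∀ x y → L (x + y) ≈ L x + L y
  L-+ x y = begin
    L (x + y)
      ≈⟨ +-congʳ (+-cong (+-cong
           (*-congˡ (trans (θ-cong (trans (θ-cong (θ-+ x y)) (θ-+ _ _))) (θ-+ _ _)))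
           (*-congˡ (trans (θ-cong (θ-+ x y)) (θ-+ _ _))))
           (*-congˡ (θ-+ x y))) ⟩
    _ ≈⟨ solve 12 (λ a b c d x₀ x₁ x₂ x₃ y₀ y₁ y₂ y₃ →
           a :* (x₃ :+ y₃) :+ b :* (x₂ :+ y₂) :+ c :* (x₁ :+ y₁) :+ d :* (x₀ :+ y₀) :=
           (a :* x₃ :+ b :* x₂ :+ c :* x₁ :+ d :* x₀) :+ (a :* y₃ :+ b :* y₂ :+ c :* y₁ :+ d :* y₀))
           refl _ _ _ _ _ _ _ _ _ _ _ _ ⟩
    L x + L y ∎

  L-scale : ∀ {a} x → θ a ≈ 0# → L (a * x) ≈ a * L x
  L-scale {a} x θa≈0 = begin
    L (a * x)
      ≈⟨ +-congʳ (+-cong (+-cong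
           (*-congˡ (trans (θ-cong (trans (θ-cong (θ-constant-* x θa≈0)) (θ-constant-* _ θa≈0))) (θ-constant-* _ θa≈0)))
           (*-congˡ (trans (θ-cong (θ-constant-* x θa≈0)) (θ-constant-* _ θa≈0))))
           (*-congˡ (θ-constant-* x θa≈0))) ⟩
    _ ≈⟨ solve 9 (λ a b c d m x₀ x₁ x₂ x₃ →
           a :* (m :* x₃) :+ b :* (m :* x₂) :+ c :* (m :* x₁) :+ d :* (m :* x₀) :=
           m :* (a :* x₃ :+ b :* x₂ :+ c :* x₁ :+ d :* x₀))
           refl _ _ _ _ _ _ _ _ _ ⟩
    a * L x ∎

  infix 4 _∶_isLogDerivativeOf_
  -- θ x / x = n / q with the denominator cleared, since the ring has no division. The summands are
  -- products of powers of s, 2 - s and 1 + 4s, and logarithmic derivatives over a common q add.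
  _∶_isLogDerivativeOf_ : Carrier → Carrier → Carrier → Set ℓ
  n ∶ q isLogDerivativeOf x = q * θ x ≈ n * x

  logDerivative-* : ∀ {q n m x y} → n ∶ q isLogDerivativeOf x → m ∶ q isLogDerivativeOf y →
                    n + m ∶ q isLogDerivativeOf x * y
  logDerivative-* {q} {n} {m} {x} {y} p r = begin
    q * θ (x * y)                 ≈⟨ *-congˡ (leibniz x y) ⟩
    q * (θ x * y + x * θ y)       ≈⟨ solve 5 (λ q x y a b → q :* (a :* y :+ x :* b) :=
                                       (q :* a) :* y :+ x :* (q :* b)) refl _ _ _ _ _ ⟩
    (q * θ x) * y + x * (q * θ y) ≈⟨ +-cong (*-congʳ p) (*-congˡ r) ⟩
    (n * x) * y + x * (m * y)     ≈⟨ solve 4 (λ n m x y → (n :* x) :* y :+ x :* (m :* y) :=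
                                       (n :+ m) :* (x :* y)) refl _ _ _ _ ⟩
    (n + m) * (x * y)             ∎

  logDerivative-^ : ∀ {q n x} j → n ∶ q isLogDerivativeOf x → ι (+ j) * n ∶ q isLogDerivativeOf x ^ j
  logDerivative-^ {q} {n} zero p = begin
    q * θ 1#           ≈⟨ *-congˡ (trans (θ-cong (sym ι-1)) (θ-ι _)) ⟩
    q * 0#             ≈⟨ zeroʳ q ⟩
    0#                 ≈⟨ zeroˡ _ ⟨
    0# * 1#            ≈⟨ *-congʳ (trans (*-congʳ ι-0) (zeroˡ n)) ⟨
    ι (+ 0) * n * 1#   ∎
  logDerivative-^ {q} {n} {x} (suc j) p = begin
    q * θ (x * x ^ j)                 ≈⟨ logDerivative-* p (logDerivative-^ j p) ⟩
    (n + ι (+ j) * n) * (x * x ^ j)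
      ≈⟨ *-congʳ (solve 2 (λ n j → n :+ j :* n := (con (+ 1) :+ j) :* n) refl _ _) ⟩
    ((ι (+ 1) + ι (+ j)) * n) * (x * x ^ j) ≈⟨ *-congʳ (*-congʳ (ι-+ (+ 1) (+ j))) ⟨
    (ι (+ suc j) * n) * (x * x ^ j)   ∎

  quadratic : Carrier → Carrier → Carrier → Carrier
  quadratic a b c = a + b * s + c * (s * s)

  θ-quadratic : ∀ {a b c} → θ a ≈ 0# → θ b ≈ 0# → θ c ≈ 0# →
                θ (quadratic a b c) ≈ b * s + ι (+ 2) * c * (s * s)
  θ-quadratic {a} {b} {c} θa θb θc = begin
    θ (a + b * s + c * (s * s)) ≈⟨ trans (θ-+ _ _) (+-congʳ (θ-+ _ _)) ⟩
    θ a + θ (b * s) + θ (c * (s * s))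
      ≈⟨ +-cong (+-cong θa (trans (θ-constant-* s θb) (*-congˡ θs≈s)))
           (trans (θ-constant-* (s * s) θc) (*-congˡ (trans (leibniz s s) (+-cong (*-congʳ θs≈s) (*-congˡ θs≈s))))) ⟩
    0# + b * s + c * (s * s + s * s)
      ≈⟨ +-cong (+-identityˡ _) (solve 2 (λ c s → c :* (s :* s :+ s :* s) := con (+ 2) :* c :* (s :* s)) refl c s) ⟩
    b * s + ι (+ 2) * c * (s * s) ∎

  θ²-quadratic : ∀ {b c} → θ b ≈ 0# → θ c ≈ 0# →
                θ (b * s + ι (+ 2) * c * (s * s)) ≈ b * s + ι (+ 4) * c * (s * s)
  θ²-quadratic {b} {c} θb θc = begin
    θ (b * s + ι (+ 2) * c * (s * s))
      ≈⟨ θ-cong (+-congʳ (sym (trans (+-congʳ ι-0) (+-identityˡ _)))) ⟩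
    θ (quadratic (ι (+ 0)) b (ι (+ 2) * c))
      ≈⟨ θ-quadratic (θ-ι _) θb (trans (θ-constant-* c (θ-ι (+ 2))) (trans (*-congˡ θc) (zeroʳ _))) ⟩
    b * s + ι (+ 2) * (ι (+ 2) * c) * (s * s)
      ≈⟨ solve 3 (λ b c s → b :* s :+ con (+ 2) :* (con (+ 2) :* c) :* (s :* s)
                    := b :* s :+ con (+ 4) :* c :* (s :* s)) refl b c s ⟩
    b * s + ι (+ 4) * c * (s * s) ∎

  -- The value of q³ L x / x when θ x / x = n / q; the arguments q₁, q₂ and n₁, n₂ are the derivatives of q and n.
  L-symbol : (q q₁ q₂ n n₁ n₂ : Carrier) → Carrier
  L-symbol q q₁ q₂ n n₁ n₂ =
      ι (+ 9) * ((ι (+ 2) - s) * (ι (+ 2) - s)) * (q * (q * n₂ + ι (+ 2) * n * n₁ - q₂ * n) + (n - ι (+ 2) * q₁) * m)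
    + s * (ι (+ 27) * s - ι (+ 54)) * q * m
    + s * (ι (+ 26) * s - ι (+ 34)) * (q * q) * n
    + s * (ι (+ 8) * s - ι (+ 8)) * (q * (q * q))
    where m = q * n₁ + n * n - q₁ * n

  -- Differentiating q θx = n x once and twice, and eliminating the lower derivatives each time,
  -- expresses q² θ²x and q³ θ³x as multiples of x. Hence `L x` is a rational multiple of x with
  -- denominator q³.
  L-logDerivative : ∀ {q q₁ q₂ n n₁ n₂ x} → θ q ≈ q₁ → θ q₁ ≈ q₂ → θ n ≈ n₁ → θ n₁ ≈ n₂ →
    n ∶ q isLogDerivativeOf x → q * (q * q) * L x ≈ L-symbol q q₁ q₂ n n₁ n₂ * x
  L-logDerivative {q} {q₁} {q₂} {n} {n₁} {n₂} {x} θq θq₁ θn θn₁ p = begin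
    q * (q * q) * L x
      ≈⟨ solve 9 (λ q a b c d x₀ x₁ x₂ x₃ →
           q :* (q :* q) :* (a :* x₃ :+ b :* x₂ :+ c :* x₁ :+ d :* x₀) :=
           a :* (q :* (q :* (q :* x₃))) :+ b :* q :* (q :* (q :* x₂))
             :+ c :* (q :* q) :* (q :* x₁) :+ d :* (q :* (q :* q)) :* x₀)
           refl q _ _ _ _ _ _ _ _ ⟩
    _ ≈⟨ +-congʳ (+-cong (+-cong (*-congˡ third) (*-congˡ second)) (*-congˡ p)) ⟩
    _ ≈⟨ solve 10 (λ q q₁ n a b c d u m x₀ →
           a :* ((q :* u :+ (n :- con (+ 2) :* q₁) :* m) :* x₀) :+ b :* q :* (m :* x₀)
             :+ c :* (q :* q) :* (n :* x₀) :+ d :* (q :* (q :* q)) :* x₀ :=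
           (a :* (q :* u :+ (n :- con (+ 2) :* q₁) :* m) :+ b :* q :* m
             :+ c :* (q :* q) :* n :+ d :* (q :* (q :* q))) :* x₀)
           refl q q₁ n _ _ _ _ _ _ _ ⟩
    L-symbol q q₁ q₂ n n₁ n₂ * x ∎
    where
    m = q * n₁ + n * n - q₁ * n
    u = q * n₂ + ι (+ 2) * n * n₁ - q₂ * n
    θp : q₁ * θ x + q * θ (θ x) ≈ n₁ * x + n * θ x
    θp = begin
      q₁ * θ x + q * θ (θ x)  ≈⟨ +-congʳ (*-congʳ θq) ⟨
      θ q * θ x + q * θ (θ x) ≈⟨ leibniz _ _ ⟨
      θ (q * θ x)             ≈⟨ θ-cong p ⟩
      θ (n * x)               ≈⟨ leibniz _ _ ⟩
      θ n * x + n * θ x       ≈⟨ +-congʳ (*-congʳ θn) ⟩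
      n₁ * x + n * θ x        ∎
    -- The second-order Leibniz rule, used on the left with a = q and y = θ x, on the right with a =
    -- n and y = x.
    θθ : ∀ {a a₁ a₂ y} → θ a ≈ a₁ → θ a₁ ≈ a₂ →
         θ (a₁ * y + a * θ y) ≈ a₂ * y + ι (+ 2) * a₁ * θ y + a * θ (θ y)
    θθ {a} {a₁} {a₂} {y} e e₁ = begin
      θ (a₁ * y + a * θ y)
        ≈⟨ trans (θ-+ _ _) (+-cong (leibniz _ _) (leibniz _ _)) ⟩
      (θ a₁ * y + a₁ * θ y) + (θ a * θ y + a * θ (θ y))
        ≈⟨ +-cong (+-congʳ (*-congʳ e₁)) (+-congʳ (*-congʳ e)) ⟩
      (a₂ * y + a₁ * θ y) + (a₁ * θ y + a * θ (θ y))
        ≈⟨ solve 6 (λ a a₁ a₂ y₀ y₁ y₂ → (a₂ :* y₀ :+ a₁ :* y₁) :+ (a₁ :* y₁ :+ a :* y₂)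
             := a₂ :* y₀ :+ con (+ 2) :* a₁ :* y₁ :+ a :* y₂) refl _ _ _ _ _ _ ⟩
      a₂ * y + ι (+ 2) * a₁ * θ y + a * θ (θ y) ∎
    θθp : q₂ * θ x + ι (+ 2) * q₁ * θ (θ x) + q * θ (θ (θ x))
          ≈ n₂ * x + ι (+ 2) * n₁ * θ x + n * θ (θ x)
    θθp = trans (sym (θθ θq θq₁)) (trans (θ-cong θp) (θθ θn θn₁))
    second : q * (q * θ (θ x)) ≈ m * x
    second = begin
      q * (q * θ (θ x))
        ≈⟨ solve 4 (λ q q₁ x₁ x₂ → q :* (q :* x₂) :=
             q :* (q₁ :* x₁ :+ q :* x₂) :- q₁ :* (q :* x₁)) refl q q₁ _ _ ⟩
      q * (q₁ * θ x + q * θ (θ x)) - q₁ * (q * θ x)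
        ≈⟨ +-congʳ (*-congˡ θp) ⟩
      q * (n₁ * x + n * θ x) - q₁ * (q * θ x)
        ≈⟨ solve 6 (λ q q₁ n n₁ x x₁ → q :* (n₁ :* x :+ n :* x₁) :- q₁ :* (q :* x₁) :=
             q :* n₁ :* x :+ (n :- q₁) :* (q :* x₁)) refl q q₁ n n₁ x _ ⟩
      q * n₁ * x + (n - q₁) * (q * θ x)
        ≈⟨ +-congˡ (*-congˡ p) ⟩
      q * n₁ * x + (n - q₁) * (n * x)
        ≈⟨ solve 5 (λ q q₁ n n₁ x → q :* n₁ :* x :+ (n :- q₁) :* (n :* x) :=
             (q :* n₁ :+ n :* n :- q₁ :* n) :* x) refl q q₁ n n₁ x ⟩
      m * x ∎
    third : q * (q * (q * θ (θ (θ x)))) ≈ (q * u + (n - ι (+ 2) * q₁) * m) * x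
    third = begin
      q * (q * (q * θ (θ (θ x))))
        ≈⟨ solve 6 (λ q q₁ q₂ x₁ x₂ x₃ → q :* (q :* (q :* x₃)) :=
             q :* (q :* (q₂ :* x₁ :+ con (+ 2) :* q₁ :* x₂ :+ q :* x₃))
             :- (con (+ 2) :* q₁ :* (q :* (q :* x₂)) :+ q :* q₂ :* (q :* x₁))) refl q q₁ q₂ _ _ _ ⟩
      q * (q * (q₂ * θ x + ι (+ 2) * q₁ * θ (θ x) + q * θ (θ (θ x))))
        - (ι (+ 2) * q₁ * (q * (q * θ (θ x))) + q * q₂ * (q * θ x))
        ≈⟨ +-congʳ (*-congˡ (*-congˡ θθp)) ⟩
      q * (q * (n₂ * x + ι (+ 2) * n₁ * θ x + n * θ (θ x)))
        - (ι (+ 2) * q₁ * (q * (q * θ (θ x))) + q * q₂ * (q * θ x))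
        ≈⟨ solve 9 (λ q q₁ q₂ n n₁ n₂ x x₁ x₂ →
             q :* (q :* (n₂ :* x :+ con (+ 2) :* n₁ :* x₁ :+ n :* x₂))
               :- (con (+ 2) :* q₁ :* (q :* (q :* x₂)) :+ q :* q₂ :* (q :* x₁)) :=
             q :* q :* n₂ :* x :+ (con (+ 2) :* q :* n₁ :- q :* q₂) :* (q :* x₁)
               :+ (n :- con (+ 2) :* q₁) :* (q :* (q :* x₂))) refl q q₁ q₂ n n₁ n₂ x _ _ ⟩
      q * q * n₂ * x + (ι (+ 2) * q * n₁ - q * q₂) * (q * θ x) + (n - ι (+ 2) * q₁) * (q * (q * θ (θ x)))
        ≈⟨ +-cong (+-congˡ (*-congˡ p)) (*-congˡ second) ⟩
      q * q * n₂ * x + (ι (+ 2) * q * n₁ - q * q₂) * (n * x) + (n - ι (+ 2) * q₁) * (m * x)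
        ≈⟨ solve 8 (λ q q₁ q₂ n n₁ n₂ x m →
             q :* q :* n₂ :* x :+ (con (+ 2) :* q :* n₁ :- q :* q₂) :* (n :* x) :+ (n :- con (+ 2) :* q₁) :* (m :* x)
             := (q :* (q :* n₂ :+ con (+ 2) :* n :* n₁ :- q₂ :* n) :+ (n :- con (+ 2) :* q₁) :* m) :* x)
             refl q q₁ q₂ n n₁ n₂ x _ ⟩
      (q * u + (n - ι (+ 2) * q₁) * m) * x ∎

  -- m L (x k) is a difference of consecutive terms, so that the sum telescopes.
  annihilates : ∀ (m y z : Carrier) (x : ℕ → Carrier) (α r : ℕ → ℤ) n →
    (∀ k → k ℕ.≤ n → m * L (x k) ≈ ι (+ 18 ℤ.* (+ k ℤ.* (+ k ℤ.* + k))) * (y * x k) - ι (r k) * (z * x k)) →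
    (∀ k → k ℕ.< n → z * x k ≈ y * x (suc k)) →
    (∀ k → k ℕ.< n → ι (+ 18 ℤ.* (+ suc k ℤ.* (+ suc k ℤ.* + suc k)) ℤ.* α (suc k)) ≈ ι (r k ℤ.* α k)) →
    ι (r n ℤ.* α n) ≈ 0# →
    m * L (∑ n (λ k → ι (α k) * x k)) ≈ 0#
  annihilates m y z x α r n Lx shift recurrence terminates = begin
    m * L (∑ n (λ k → ι (α k) * x k)) ≈⟨ telescope n ℕ.≤-refl ⟩
    - (ι (r n ℤ.* α n) * (z * x n))   ≈⟨ -‿cong (trans (*-congʳ terminates) (zeroˡ _)) ⟩
    - 0#                              ≈⟨ -0#≈0# ⟩
    0#                                ∎
    where
    open import Algebra.Properties.Ring ring using (-0#≈0#)
    cube : ℕ → ℤ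
    cube k = + 18 ℤ.* (+ k ℤ.* (+ k ℤ.* + k))
    term : ∀ k → k ℕ.≤ n → m * L (ι (α k) * x k) ≈
           ι (cube k ℤ.* α k) * (y * x k) - ι (r k ℤ.* α k) * (z * x k)
    term k k≤n = begin
      m * L (ι (α k) * x k)   ≈⟨ *-congˡ (L-scale (x k) (θ-ι _)) ⟩
      m * (ι (α k) * L (x k)) ≈⟨ solve 3 (λ m a l → m :* (a :* l) := a :* (m :* l)) refl _ _ _ ⟩
      ι (α k) * (m * L (x k)) ≈⟨ *-congˡ (Lx k k≤n) ⟩
      ι (α k) * (ι (cube k) * (y * x k) - ι (r k) * (z * x k))
        ≈⟨ solve 5 (λ a c r u v → a :* (c :* u :- r :* v) := (c :* a) :* u :- (r :* a) :* v) refl _ _ _ _ _ ⟩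
      (ι (cube k) * ι (α k)) * (y * x k) - (ι (r k) * ι (α k)) * (z * x k)
        ≈⟨ +-cong (*-congʳ (ι-* _ _)) (-‿cong (*-congʳ (ι-* _ _))) ⟨
      ι (cube k ℤ.* α k) * (y * x k) - ι (r k ℤ.* α k) * (z * x k) ∎
    -- Only the upper boundary term survives. The lower one carries k³ at k = 0; in between, `shift`
    -- and `recurrence` make the z-part of term j cancel the y-part of term j + 1.
    telescope : ∀ j → j ℕ.≤ n → m * L (∑ j (λ k → ι (α k) * x k)) ≈ - (ι (r j ℤ.* α j) * (z * x j))
    telescope zero 0≤n = begin
      m * L (ι (α 0) * x 0) ≈⟨ term 0 0≤n ⟩
      ι (+ 0) * (y * x 0) - ι (r 0 ℤ.* α 0) * (z * x 0)
        ≈⟨ solve 2 (λ u v → con (+ 0) :* u :- v := :- v) refl _ _ ⟩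
      - (ι (r 0 ℤ.* α 0) * (z * x 0)) ∎
    telescope (suc j) j<n = begin
      m * L (∑ j (λ k → ι (α k) * x k) + ι (α (suc j)) * x (suc j))
        ≈⟨ trans (*-congˡ (L-+ _ _)) (distribˡ m _ _) ⟩
      m * L (∑ j (λ k → ι (α k) * x k)) + m * L (ι (α (suc j)) * x (suc j))
        ≈⟨ +-cong (telescope j (ℕ.<⇒≤ j<n)) (term (suc j) j<n) ⟩
      - (ι (r j ℤ.* α j) * (z * x j)) +
        (ι (cube (suc j) ℤ.* α (suc j)) * (y * x (suc j)) - ι (r (suc j) ℤ.* α (suc j)) * (z * x (suc j)))
        ≈⟨ +-cong (-‿cong (*-congˡ (shift j j<n))) (+-congʳ (*-congʳ (recurrence j j<n))) ⟩
      - (ι (r j ℤ.* α j) * (y * x (suc j))) +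
        (ι (r j ℤ.* α j) * (y * x (suc j)) - ι (r (suc j) ℤ.* α (suc j)) * (z * x (suc j)))
        ≈⟨ solve 2 (λ u v → :- u :+ (u :- v) := :- v) refl _ _ ⟩
      - (ι (r (suc j) ℤ.* α (suc j)) * (z * x (suc j))) ∎

  private
    quadraticP : ∀ {n} → Polynomial n → (a b c : Polynomial n) → Polynomial n
    quadraticP s a b c = a :+ b :* s :+ c :* (s :* s)

    -- The solver's syntax for `L-symbol` at quadratic q and n, with coefficients `a₀ a₁ a₂` and
    -- `b₀ b₁ b₂`. The derivatives are already substituted, as θ s = s and θ s² = 2 s².
    L-symbolP : ∀ {n} (s a₀ a₁ a₂ b₀ b₁ b₂ : Polynomial n) → Polynomial n
    L-symbolP s a₀ a₁ a₂ b₀ b₁ b₂ =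
        con (+ 9) :* ((con (+ 2) :- s) :* (con (+ 2) :- s))
          :* (q :* (q :* n₂ :+ con (+ 2) :* n :* n₁ :- q₂ :* n) :+ (n :- con (+ 2) :* q₁) :* m)
      :+ s :* (con (+ 27) :* s :- con (+ 54)) :* q :* m
      :+ s :* (con (+ 26) :* s :- con (+ 34)) :* (q :* q) :* n
      :+ s :* (con (+ 8) :* s :- con (+ 8)) :* (q :* (q :* q))
      where
      q = quadraticP s a₀ a₁ a₂
      q₁ = a₁ :* s :+ con (+ 2) :* a₂ :* (s :* s)
      q₂ = a₁ :* s :+ con (+ 4) :* a₂ :* (s :* s)
      n = quadraticP s b₀ b₁ b₂
      n₁ = b₁ :* s :+ con (+ 2) :* b₂ :* (s :* s)
      n₂ = b₁ :* s :+ con (+ 4) :* b₂ :* (s :* s)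
      m = q :* n₁ :+ n :* n :- q₁ :* n

  -- For both families of summands the logarithmic derivative is a quotient of polynomials of degree
  -- at most 2 in s with constant coefficients. Its derivatives are then explicit, and nothing about
  -- `x` beyond `θ x` is required.
  L-quadratic : ∀ {a₀ a₁ a₂ b₀ b₁ b₂ x} →
    θ a₀ ≈ 0# → θ a₁ ≈ 0# → θ a₂ ≈ 0# → θ b₀ ≈ 0# → θ b₁ ≈ 0# → θ b₂ ≈ 0# →
    quadratic b₀ b₁ b₂ ∶ quadratic a₀ a₁ a₂ isLogDerivativeOf x →
    quadratic a₀ a₁ a₂ * (quadratic a₀ a₁ a₂ * quadratic a₀ a₁ a₂) * L x ≈
    L-symbol (quadratic a₀ a₁ a₂) (a₁ * s + ι (+ 2) * a₂ * (s * s)) (a₁ * s + ι (+ 4) * a₂ * (s * s))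
             (quadratic b₀ b₁ b₂) (b₁ * s + ι (+ 2) * b₂ * (s * s)) (b₁ * s + ι (+ 4) * b₂ * (s * s)) * x
  L-quadratic θa₀ θa₁ θa₂ θb₀ θb₁ θb₂ = L-logDerivative
    (θ-quadratic θa₀ θa₁ θa₂) (θ²-quadratic θa₁ θa₂) (θ-quadratic θb₀ θb₁ θb₂) (θ²-quadratic θb₁ θb₂)

  ι-affine : ∀ a b k → ι (affine a b k) ≈ ι a + ι b * ι (+ k)
  ι-affine a b k = trans (ι-+ _ _) (+-congˡ (ι-* _ _))

  θ-affine : ∀ a b k → θ (ι a + ι b * ι (+ k)) ≈ 0#
  θ-affine a b k = trans (θ-cong (sym (ι-affine a b k))) (θ-ι _)

  ι-cube : ∀ k → ι (+ 18 ℤ.* (+ k ℤ.* (+ k ℤ.* + k))) ≈ ι (+ 18) * (ι (+ k) * (ι (+ k) * ι (+ k)))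
  ι-cube k = trans (ι-* _ _) (*-congˡ (trans (ι-* _ _) (*-congˡ (ι-* _ _))))

  ι-affine³ : ∀ a b c d e f k → ι (affine a b k ℤ.* (affine c d k ℤ.* affine e f k)) ≈
    (ι a + ι b * ι (+ k)) * ((ι c + ι d * ι (+ k)) * (ι e + ι f * ι (+ k)))
  ι-affine³ a b c d e f k = trans (ι-* _ _) (*-cong (ι-affine a b k)
    (trans (ι-* _ _) (*-cong (ι-affine c d k) (ι-affine e f k))))

  2-s 1+4s : Carrier
  2-s  = ι (+ 2) - s
  1+4s = ι (+ 1) + ι (+ 4) * s

  -- A common denominator for both families, so that the difference of the two sums is annihilated
  -- by a single operator. Its constant term is 16, so it can be cancelled when coefficients are
  -- compared.
  multiplier : Carrier
  multiplier = (2-s * 1+4s) * ((2-s * 1+4s) * (2-s * 1+4s)) * 2-s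

  -- The factor 1 - s is the square root of 1 - s(2-s), which vanishes over the singular point 1 of
  -- the hypergeometric equation; the cube only matches the denominator of the second family.
  y₁ : Carrier
  y₁ = ι (+ 4) * (ι (+ 1) - s) * ((2-s * 1+4s) * ((2-s * 1+4s) * (2-s * 1+4s)))

  θ-2-s : θ 2-s ≈ - s
  θ-2-s = begin
    θ (ι (+ 2) - s) ≈⟨ θ-cong (solve 1 (λ s → con (+ 2) :- s := con (+ 2) :+ con -[1+ 0 ] :* s) refl s) ⟩
    θ (ι (+ 2) + ι -[1+ 0 ] * s) ≈⟨ θ-+ _ _ ⟩
    θ (ι (+ 2)) + θ (ι -[1+ 0 ] * s) ≈⟨ +-cong (θ-ι _) (trans (θ-constant-* s (θ-ι _)) (*-congˡ θs≈s)) ⟩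
    0# + ι -[1+ 0 ] * s ≈⟨ +-identityˡ _ ⟩
    ι -[1+ 0 ] * s ≈⟨ solve 1 (λ s → con -[1+ 0 ] :* s := :- s) refl s ⟩
    - s ∎

  θ-1+4s : θ 1+4s ≈ ι (+ 4) * s
  θ-1+4s = trans (θ-+ _ _)
    (trans (+-cong (θ-ι _) (trans (θ-constant-* s (θ-ι _)) (*-congˡ θs≈s))) (+-identityˡ _))

  -- With z = s(2-s), and without the common cube ((2-s)(1+4s))³, this reads (2-s) L zᵏ =
  -- 4(1-s)(18k³ zᵏ - r₁(k) zᵏ⁺¹). Up to a factor, `L` is the hypergeometric operator written in the
  -- variable s.
  L-term₁ : ∀ k → let x = (s * 2-s) ^ k in multiplier * L x ≈
    ι (+ 18 ℤ.* (+ k ℤ.* (+ k ℤ.* + k))) * (y₁ * x) - ι (r₁ k) * ((y₁ * (s * 2-s)) * x)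
  L-term₁ k = begin
    multiplier * L x
      ≈⟨ solve 2 (λ s l →
           let u = con (+ 2) :- s ; v = con (+ 1) :+ con (+ 4) :* s
               q = quadraticP s (con (+ 2)) (con -[1+ 0 ]) (con (+ 0)) in
           (u :* v) :* ((u :* v) :* (u :* v)) :* u :* l :=
           v :* (v :* v) :* u :* (q :* (q :* q) :* l)) refl s (L x) ⟩
    _ ≈⟨ *-congˡ (L-quadratic (θ-ι _) (θ-ι _) (θ-ι _) (θ-affine (+ 0) (+ 2) k) (θ-affine (+ 0) -[1+ 1 ] k) (θ-ι _) ld) ⟩
    _ ≈⟨ solve 3 (λ s k x →
           let u = con (+ 2) :- s ; v = con (+ 1) :+ con (+ 4) :* s
               y = con (+ 4) :* (con (+ 1) :- s) :* ((u :* v) :* ((u :* v) :* (u :* v))) in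
           v :* (v :* v) :* u :* (L-symbolP s (con (+ 2)) (con -[1+ 0 ]) (con (+ 0))
             (con (+ 0) :+ con (+ 2) :* k) (con (+ 0) :+ con -[1+ 1 ] :* k) (con (+ 0)) :* x) :=
           con (+ 18) :* (k :* (k :* k)) :* (y :* x) :-
           (con (+ 1) :+ con (+ 3) :* k) :* ((con (+ 1) :+ con (+ 2) :* k) :* (con (+ 2) :+ con (+ 3) :* k))
             :* ((y :* (s :* u)) :* x)) refl s (ι (+ k)) x ⟩
    _ ≈⟨ +-cong (*-congʳ (ι-cube k)) (-‿cong (*-congʳ (ι-affine³ (+ 1) (+ 3) (+ 1) (+ 2) (+ 2) (+ 3) k))) ⟨
    ι (+ 18 ℤ.* (+ k ℤ.* (+ k ℤ.* + k))) * (y₁ * x) - ι (r₁ k) * ((y₁ * (s * 2-s)) * x) ∎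
    where
    x = (s * 2-s) ^ k
    ld-2-s : - s ∶ 2-s isLogDerivativeOf 2-s
    ld-2-s = trans (*-congˡ θ-2-s) (*-comm _ _)
    ld : quadratic (ι (+ 0) + ι (+ 2) * ι (+ k)) (ι (+ 0) + ι -[1+ 1 ] * ι (+ k)) (ι (+ 0))
         ∶ quadratic (ι (+ 2)) (ι -[1+ 0 ]) (ι (+ 0)) isLogDerivativeOf x
    ld = begin
      quadratic (ι (+ 2)) (ι -[1+ 0 ]) (ι (+ 0)) * θ x
        ≈⟨ *-congʳ (solve 1 (λ s → quadraticP s (con (+ 2)) (con -[1+ 0 ]) (con (+ 0)) := con (+ 2) :- s) refl s) ⟩
      2-s * θ x
        ≈⟨ logDerivative-^ k (logDerivative-* (*-congˡ θs≈s) ld-2-s) ⟩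
      ι (+ k) * (2-s + - s) * x
        ≈⟨ *-congʳ (solve 2 (λ s k → k :* (con (+ 2) :- s :+ :- s) :=
             quadraticP s (con (+ 0) :+ con (+ 2) :* k) (con (+ 0) :+ con -[1+ 1 ] :* k) (con (+ 0))) refl s (ι (+ k))) ⟩
      _ ∎

  -- A quarter of the numerator of the hypergeometric argument 4s(2-s)³/(1+4s)³.
  Z : Carrier
  Z = s * (2-s * (2-s * 2-s))

  -- The factor 1 − 10s − 2s² is the square root of (1 + 4s)³ − 4Z, whose zeros lie over
  -- the third singular point of the hypergeometric equation.
  y₂ z₂ : Carrier
  y₂ = ι (+ 4) * (ι (+ 1) - ι (+ 10) * s - ι (+ 2) * (s * s)) * ((2-s * 1+4s) * ((2-s * 1+4s) * (2-s * 1+4s)))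
  z₂ = ι (+ 4) * (ι (+ 1) - ι (+ 10) * s - ι (+ 2) * (s * s)) * ((2-s * (2-s * 2-s)) * Z)

  -- The hypothesis says that j stands for -1/2 - 3k, so x plays the role of (1+4s)^(-1/2)
  -- (Z/(1+4s)³)ᵏ. Since z₂/y₂ is Z/(1+4s)³, the right side is again the hypergeometric operator on
  -- the kth power of its variable.
  L-term₂ : ∀ k j → ι (+ 2) * ι (+ j) + ι (+ 1) + ι (+ 6) * ι (+ k) ≈ 0# →
    let x = Z ^ k * 1+4s ^ j in multiplier * L x ≈
    ι (+ 18 ℤ.* (+ k ℤ.* (+ k ℤ.* + k))) * (y₂ * x) - ι (r₂ k) * (z₂ * x)
  L-term₂ k j 2j≈-1-6k = begin
    multiplier * L x
      ≈⟨ solve 2 (λ s l →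
           let u = con (+ 2) :- s ; v = con (+ 1) :+ con (+ 4) :* s
               q = quadraticP s (con (+ 2)) (con (+ 7)) (con -[1+ 3 ]) in
           (u :* v) :* ((u :* v) :* (u :* v)) :* u :* l :=
           u :* (q :* (q :* q) :* l)) refl s (L x) ⟩
    _ ≈⟨ *-congˡ (L-quadratic (θ-ι _) (θ-ι _) (θ-ι _)
           (θ-affine (+ 0) (+ 2) k) (θ-affine -[1+ 3 ] -[1+ 19 ] k) (θ-affine (+ 2) -[1+ 3 ] k) ld) ⟩
    _ ≈⟨ solve 3 (λ s k x →
           let u = con (+ 2) :- s ; v = con (+ 1) :+ con (+ 4) :* s
               e = con (+ 4) :* (con (+ 1) :- con (+ 10) :* s :- con (+ 2) :* (s :* s)) in
           u :* (L-symbolP s (con (+ 2)) (con (+ 7)) (con -[1+ 3 ])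
             (con (+ 0) :+ con (+ 2) :* k) (con -[1+ 3 ] :+ con -[1+ 19 ] :* k) (con (+ 2) :+ con -[1+ 3 ] :* k) :* x) :=
           con (+ 18) :* (k :* (k :* k)) :* (e :* ((u :* v) :* ((u :* v) :* (u :* v))) :* x) :-
           (con (+ 1) :+ con (+ 6) :* k) :* ((con (+ 1) :+ con (+ 2) :* k) :* (con (+ 5) :+ con (+ 6) :* k))
             :* (e :* ((u :* (u :* u)) :* (s :* (u :* (u :* u)))) :* x)) refl s (ι (+ k)) x ⟩
    _ ≈⟨ +-cong (*-congʳ (ι-cube k)) (-‿cong (*-congʳ (ι-affine³ (+ 1) (+ 6) (+ 1) (+ 2) (+ 5) (+ 6) k))) ⟨
    ι (+ 18 ℤ.* (+ k ℤ.* (+ k ℤ.* + k))) * (y₂ * x) - ι (r₂ k) * (z₂ * x) ∎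
    where
    x = Z ^ k * 1+4s ^ j
    q = 2-s * 1+4s
    ld-2-s : - (s * 1+4s) ∶ q isLogDerivativeOf 2-s
    ld-2-s = trans (*-congˡ θ-2-s)
      (solve 3 (λ s u v → (u :* v) :* (:- s) := (:- (s :* v)) :* u) refl s 2-s 1+4s)
    ld-1+4s : ι (+ 4) * s * 2-s ∶ q isLogDerivativeOf 1+4s
    ld-1+4s = trans (*-congˡ θ-1+4s)
      (solve 3 (λ s u v → (u :* v) :* (con (+ 4) :* s) := (con (+ 4) :* s :* u) :* v) refl s 2-s 1+4s)
    ld : quadratic (ι (+ 0) + ι (+ 2) * ι (+ k)) (ι -[1+ 3 ] + ι -[1+ 19 ] * ι (+ k)) (ι (+ 2) + ι -[1+ 3 ] * ι (+ k))
         ∶ quadratic (ι (+ 2)) (ι (+ 7)) (ι -[1+ 3 ]) isLogDerivativeOf x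
    ld = begin
      quadratic (ι (+ 2)) (ι (+ 7)) (ι -[1+ 3 ]) * θ x
        ≈⟨ *-congʳ (solve 1 (λ s → quadraticP s (con (+ 2)) (con (+ 7)) (con -[1+ 3 ])
             := (con (+ 2) :- s) :* (con (+ 1) :+ con (+ 4) :* s)) refl s) ⟩
      q * θ x
        ≈⟨ logDerivative-*
             (logDerivative-^ k (logDerivative-* (*-congˡ θs≈s)
               (logDerivative-* ld-2-s (logDerivative-* ld-2-s ld-2-s))))
             (logDerivative-^ j ld-1+4s) ⟩
      -- The exponent j enters the logarithmic derivative only through 2j. Splitting off 2j + 1 +
      -- 6k, which vanishes, leaves a numerator whose coefficients are affine in k.
      _ ≈⟨ *-congʳ (solve 3 (λ s k j →
             let u = con (+ 2) :- s ; v = con (+ 1) :+ con (+ 4) :* s ; w = :- (s :* v) in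
             k :* ((u :* v) :+ (w :+ (w :+ w))) :+ j :* (con (+ 4) :* s :* u) :=
             (con (+ 2) :* j :+ con (+ 1) :+ con (+ 6) :* k) :* (con (+ 2) :* s :* u) :+
             quadraticP s (con (+ 0) :+ con (+ 2) :* k) (con -[1+ 3 ] :+ con -[1+ 19 ] :* k) (con (+ 2) :+ con -[1+ 3 ] :* k))
             refl s (ι (+ k)) (ι (+ j))) ⟩
      _ ≈⟨ *-congʳ (trans (+-congʳ (trans (*-congʳ 2j≈-1-6k) (zeroˡ _))) (+-identityˡ _)) ⟩
      _ ∎

  module _ (h : ℕ) (2h+1≈0 : ι (+ 2) * ι (+ h) + ι (+ 1) ≈ 0#) where

    hypergeometric₁-annihilated : ∀ (α : ℕ → ℤ) →
      (∀ k → ι (+ 18 ℤ.* (+ suc k ℤ.* (+ suc k ℤ.* + suc k)) ℤ.* α (suc k)) ≈ ι (r₁ k ℤ.* α k)) →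
      multiplier * L (∑ h (λ k → ι (α k) * (s * 2-s) ^ k)) ≈ 0#
    hypergeometric₁-annihilated α recurrence =
      annihilates _ y₁ (y₁ * (s * 2-s)) _ α r₁ h (λ k _ → L-term₁ k) (λ k _ → *-assoc _ _ _)
        (λ k _ → recurrence k) (trans (ι-* _ _) (trans (*-congʳ r₁h≈0) (zeroˡ _)))
      where
      r₁h≈0 : ι (r₁ h) ≈ 0#
      r₁h≈0 = begin
        ι (r₁ h) ≈⟨ ι-affine³ (+ 1) (+ 3) (+ 1) (+ 2) (+ 2) (+ 3) h ⟩
        _ ≈⟨ solve 2 (λ h a → (con (+ 1) :+ con (+ 3) :* h) :* ((con (+ 1) :+ con (+ 2) :* h) :* (con (+ 2) :+ con (+ 3) :* h))
               := (con (+ 1) :+ con (+ 3) :* h) :* (con (+ 2) :+ con (+ 3) :* h) :* (con (+ 2) :* h :+ con (+ 1)))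
               refl (ι (+ h)) 0# ⟩
        _ ≈⟨ trans (*-congˡ 2h+1≈0) (zeroʳ _) ⟩
        0# ∎

    hypergeometric₂-annihilated : ∀ (β : ℕ → ℤ) n → 3 ℕ.* n ℕ.≤ h →
      (∀ k → ι (+ 18 ℤ.* (+ suc k ℤ.* (+ suc k ℤ.* + suc k)) ℤ.* β (suc k)) ≈ ι (r₂ k ℤ.* β k)) →
      ι (r₂ n) ≈ 0# →
      multiplier * L (∑ n (λ k → ι (β k) * (Z ^ k * 1+4s ^ (h ℕ.∸ 3 ℕ.* k)))) ≈ 0#
    hypergeometric₂-annihilated β n 3n≤h recurrence r₂n≈0 =
      annihilates _ y₂ z₂ _ β r₂ n (λ k k≤n → L-term₂ k _ (exponent k k≤n)) shift
        (λ k _ → recurrence k) (trans (ι-* _ _) (trans (*-congʳ r₂n≈0) (zeroˡ _)))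
      where
      -- 2(h - 3k) + 1 + 6k = 2h + 1; the truncated subtraction is exact because 3k ≤ 3n ≤ h.
      exponent : ∀ k → k ℕ.≤ n → ι (+ 2) * ι (+ (h ℕ.∸ 3 ℕ.* k)) + ι (+ 1) + ι (+ 6) * ι (+ k) ≈ 0#
      exponent k k≤n = begin
        ι (+ 2) * ι (+ j) + ι (+ 1) + ι (+ 6) * ι (+ k)
          ≈⟨ solve 2 (λ j k → con (+ 2) :* j :+ con (+ 1) :+ con (+ 6) :* k :=
               con (+ 2) :* (j :+ con (+ 3) :* k) :+ con (+ 1)) refl _ _ ⟩
        ι (+ 2) * (ι (+ j) + ι (+ 3) * ι (+ k)) + ι (+ 1)
          ≈⟨ +-congʳ (*-congˡ (trans (ι-+ (+ j) (+ 3 ℤ.* + k)) (+-congˡ (ι-* _ _)))) ⟨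
        ι (+ 2) * ι (+ j ℤ.+ + 3 ℤ.* + k) + ι (+ 1)
          ≈⟨ +-congʳ (*-congˡ (ι-≡ (≡.trans (≡.cong (λ m → + j ℤ.+ m) (≡.sym (ℤ.pos-* 3 k)))
               (≡.cong +_ (ℕ.m∸n+n≡m (ℕ.≤-trans (ℕ.*-monoʳ-≤ 3 k≤n) 3n≤h)))))) ⟩
        ι (+ 2) * ι (+ h) + ι (+ 1) ≈⟨ 2h+1≈0 ⟩
        0# ∎
        where j = h ℕ.∸ 3 ℕ.* k
      -- From k to k + 1 the exponent of 1 + 4s falls by 3. The three factors released turn z₂ Zᵏ,
      -- with its extra Z, into y₂ Zᵏ⁺¹.
      shift : ∀ k → k ℕ.< n → z₂ * (Z ^ k * 1+4s ^ (h ℕ.∸ 3 ℕ.* k)) ≈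
              y₂ * (Z ^ suc k * 1+4s ^ (h ℕ.∸ 3 ℕ.* suc k))
      shift k k<n = begin
        z₂ * (Z ^ k * 1+4s ^ (h ℕ.∸ 3 ℕ.* k))
          ≈⟨ *-congˡ (*-congˡ (reflexive (≡.cong (1+4s ^_) j≡3+i))) ⟩
        z₂ * (Z ^ k * (1+4s * (1+4s * (1+4s * 1+4s ^ i))))
          ≈⟨ solve 6 (λ e s u v a b →
               e :* ((u :* (u :* u)) :* (s :* (u :* (u :* u)))) :* (a :* (v :* (v :* (v :* b)))) :=
               e :* ((u :* v) :* ((u :* v) :* (u :* v))) :* (s :* (u :* (u :* u)) :* a :* b))
               refl _ s 2-s 1+4s _ _ ⟩
        y₂ * (Z ^ suc k * 1+4s ^ i) ∎
        where
        i = h ℕ.∸ 3 ℕ.* suc k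
        j≡3+i : h ℕ.∸ 3 ℕ.* k ≡ 3 ℕ.+ i
        j≡3+i = ≡.trans (≡.sym (ℕ.m+[n∸m]≡n {3} (ℕ.m+n≤o⇒m≤o∸n 3 3+3k≤h)))
          (≡.cong (3 ℕ.+_) (≡.trans (ℕ.∸-+-assoc h (3 ℕ.* k) 3)
            (≡.cong (h ℕ.∸_) (≡.trans (ℕ.+-comm (3 ℕ.* k) 3) (≡.sym (ℕ.*-suc 3 k))))))
          where
          3+3k≤h : 3 ℕ.+ 3 ℕ.* k ℕ.≤ h
          3+3k≤h = ℕ.≤-trans (ℕ.≤-reflexive (≡.sym (ℕ.*-suc 3 k)))
            (ℕ.≤-trans (ℕ.*-monoʳ-≤ 3 k<n) 3n≤h)

-- Products of binomial coefficients

module BinomialProducts where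
  open import Data.Nat using (_*_; _+_; _∸_)
  open import Relation.Binary.PropositionalEquality using (refl; cong; cong₂; sym; trans)

  n∣n! : ∀ {n} → 0 ℕ.< n → n ℕ.∣ n !
  n∣n! {suc n} _ = ℕ.m∣m*n (n !)

  nCk*k![n-k]!≡n! : ∀ {n k} → k ℕ.≤ n → (n C k) * (k ! * (n ∸ k) !) ≡ n !
  nCk*k![n-k]!≡n! {n} {k} k≤n = trans
    (cong (_* (k ! * (n ∸ k) !)) (nCk≡n!/k![n-k]! k≤n)) (ℕ.m/n*n≡m (k![n∸k]!∣n! k≤n))
    where instance _ = k ℕ.!* (n ∸ k) !≢0

  [m+n]Cm*m!n!≡[m+n]! : ∀ m n → ((m + n) C m) * (m ! * n !) ≡ (m + n) !
  [m+n]Cm*m!n!≡[m+n]! m n = trans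
    (cong (λ k → ((m + n) C m) * (m ! * k !)) (sym (ℕ.m+n∸m≡n m n)))
    (nCk*k![n-k]!≡n! (ℕ.m≤m+n m n))

  -- c = n/d and c′ = n′/d′; if the denominator grows by the factor e and the numerator by f, the
  -- quotient grows by f/e.
  quotient-recurrence : ∀ {c c′ d d′ n n′} e f .{{_ : ℕ.NonZero d}} →
    c * d ≡ n → c′ * d′ ≡ n′ → d′ ≡ e * d → n′ ≡ f * n → e * c′ ≡ f * c
  quotient-recurrence {c} {c′} {d} e f refl refl d′≡ed n′≡fn = ℕ.*-cancelʳ-≡ _ _ d
    (trans (solve 3 (λ e c′ d → e :* c′ :* d := c′ :* (e :* d)) refl e c′ d)
    (trans (cong (c′ *_) (sym d′≡ed)) (trans n′≡fn (sym (ℕ.*-assoc f c d)))))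
    where open ℕ.+-*-Solver

  [2k+2]! : ∀ k → (2 * suc k) ! ≡ (2 + 2 * k) * ((1 + 2 * k) * (2 * k) !)
  [2k+2]! k = cong _! (ℕ.*-suc 2 k)

  [3k+3]! : ∀ k → (3 * suc k) ! ≡ (3 + 3 * k) * ((2 + 3 * k) * ((1 + 3 * k) * (3 * k) !))
  [3k+3]! k = cong _! (ℕ.*-suc 3 k)

  [6k+6]! : ∀ k → (6 * suc k) ! ≡ (6 + 6 * k) * ((5 + 6 * k) * ((4 + 6 * k) *
                    ((3 + 6 * k) * ((2 + 6 * k) * ((1 + 6 * k) * (6 * k) !)))))
  [6k+6]! k = cong _! (ℕ.*-suc 6 k)

  2kCk 3kCk 6kC3k : ℕ → ℕ
  2kCk  k = (2 * k) C k
  3kCk  k = (3 * k) C k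
  6kC3k k = (6 * k) C (3 * k)

  2kCk-factorial : ∀ k → 2kCk k * (k ! * k !) ≡ (2 * k) !
  2kCk-factorial k = trans (cong (λ n → 2kCk k * (k ! * n !)) (sym (ℕ.+-identityʳ k)))
    ([m+n]Cm*m!n!≡[m+n]! k (k + 0))

  6kC3k-factorial : ∀ k → 6kC3k k * ((3 * k) ! * (3 * k) !) ≡ (6 * k) !
  6kC3k-factorial k = ≡.subst (λ n → (n C (3 * k)) * ((3 * k) ! * (3 * k) !) ≡ n !)
    (solve 1 (λ k → con 3 :* k :+ con 3 :* k := con 6 :* k) refl k) ([m+n]Cm*m!n!≡[m+n]! (3 * k) (3 * k))
    where open ℕ.+-*-Solver

  2kCk-suc : ∀ k → (1 + k) * 2kCk (suc k) ≡ 2 * (1 + 2 * k) * 2kCk k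
  2kCk-suc k = ℕ.*-cancelˡ-≡ _ _ (suc k) (trans (sym (ℕ.*-assoc (suc k) (suc k) _))
    (trans (quotient-recurrence (suc k * suc k) ((2 + 2 * k) * (1 + 2 * k))
      (2kCk-factorial k) (2kCk-factorial (suc k))
      (solve 2 (λ k f → (con 1 :+ k) :* f :* ((con 1 :+ k) :* f) := (con 1 :+ k) :* (con 1 :+ k) :* (f :* f)) refl k (k !))
      (trans ([2k+2]! k) (sym (ℕ.*-assoc (2 + 2 * k) (1 + 2 * k) _))))
    (solve 2 (λ k c → (con 2 :+ con 2 :* k) :* (con 1 :+ con 2 :* k) :* c :=
       (con 1 :+ k) :* (con 2 :* (con 1 :+ con 2 :* k) :* c)) refl k (2kCk k))))
    where
    open ℕ.+-*-Solver
    instance _ = k ℕ.!* k !≢0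

  3kCk-suc : ∀ k → 2 * (1 + k) * (1 + 2 * k) * 3kCk (suc k) ≡ 3 * (1 + 3 * k) * (2 + 3 * k) * 3kCk k
  3kCk-suc k = ℕ.*-cancelˡ-≡ _ _ (suc k) (trans
    (solve 2 (λ k c → (con 1 :+ k) :* (con 2 :* (con 1 :+ k) :* (con 1 :+ con 2 :* k) :* c) :=
       (con 1 :+ k) :* ((con 2 :+ con 2 :* k) :* (con 1 :+ con 2 :* k)) :* c) refl k (3kCk (suc k)))
    (trans (quotient-recurrence ((1 + k) * ((2 + 2 * k) * (1 + 2 * k))) ((3 + 3 * k) * ((2 + 3 * k) * (1 + 3 * k)))
      ([m+n]Cm*m!n!≡[m+n]! k (2 * k)) ([m+n]Cm*m!n!≡[m+n]! (suc k) (2 * suc k))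
      (trans (cong ((suc k) ! *_) ([2k+2]! k))
        (solve 5 (λ a f b c g → a :* f :* (b :* (c :* g)) := a :* (b :* c) :* (f :* g)) refl
          (1 + k) (k !) (2 + 2 * k) (1 + 2 * k) ((2 * k) !)))
      (trans ([3k+3]! k) (solve 4 (λ a b c f → a :* (b :* (c :* f)) := a :* (b :* c) :* f) refl
         (3 + 3 * k) (2 + 3 * k) (1 + 3 * k) ((3 * k) !))))
    (solve 2 (λ k c → (con 3 :+ con 3 :* k) :* ((con 2 :+ con 3 :* k) :* (con 1 :+ con 3 :* k)) :* c :=
       (con 1 :+ k) :* (con 3 :* (con 1 :+ con 3 :* k) :* (con 2 :+ con 3 :* k) :* c)) refl k (3kCk k))))
    where
    open ℕ.+-*-Solver
    instance _ = k ℕ.!* (2 * k) !≢0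

  -- In the numerator (6k+6)(6k+4)(6k+2) is 8 times (3k+3)(3k+2)(3k+1), one of the two copies in the
  -- denominator. A further 3 is common to 6k+3 and the remaining 3k+3; this is the factor
  -- cancelled.
  6kC3k-suc : ∀ k → (1 + k) * (1 + 3 * k) * (2 + 3 * k) * 6kC3k (suc k) ≡
                     8 * (1 + 6 * k) * (1 + 2 * k) * (5 + 6 * k) * 6kC3k k
  6kC3k-suc k = ℕ.*-cancelˡ-≡ _ _ (3 * ((3 + 3 * k) * ((2 + 3 * k) * (1 + 3 * k)))) (trans
    (solve 2 (λ k c → con 3 :* ((con 3 :+ con 3 :* k) :* ((con 2 :+ con 3 :* k) :* (con 1 :+ con 3 :* k)))
         :* ((con 1 :+ k) :* (con 1 :+ con 3 :* k) :* (con 2 :+ con 3 :* k) :* c) :=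
       (con 3 :+ con 3 :* k) :* ((con 2 :+ con 3 :* k) :* (con 1 :+ con 3 :* k)) :*
       ((con 3 :+ con 3 :* k) :* ((con 2 :+ con 3 :* k) :* (con 1 :+ con 3 :* k))) :* c) refl k (6kC3k (suc k)))
    (trans (quotient-recurrence
      ((3 + 3 * k) * ((2 + 3 * k) * (1 + 3 * k)) * ((3 + 3 * k) * ((2 + 3 * k) * (1 + 3 * k))))
      ((6 + 6 * k) * ((5 + 6 * k) * ((4 + 6 * k) * ((3 + 6 * k) * ((2 + 6 * k) * (1 + 6 * k))))))
      (6kC3k-factorial k) (6kC3k-factorial (suc k))
      (trans (cong (λ n → n * n) ([3k+3]! k))
        (solve 4 (λ a b c f → a :* (b :* (c :* f)) :* (a :* (b :* (c :* f))) :=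
          a :* (b :* c) :* (a :* (b :* c)) :* (f :* f)) refl (3 + 3 * k) (2 + 3 * k) (1 + 3 * k) ((3 * k) !)))
      (trans ([6k+6]! k) (solve 7 (λ a b c d e g f → a :* (b :* (c :* (d :* (e :* (g :* f))))) :=
         a :* (b :* (c :* (d :* (e :* g)))) :* f) refl
         (6 + 6 * k) (5 + 6 * k) (4 + 6 * k) (3 + 6 * k) (2 + 6 * k) (1 + 6 * k) ((6 * k) !))))
    (solve 2 (λ k c →
         (con 6 :+ con 6 :* k) :* ((con 5 :+ con 6 :* k) :* ((con 4 :+ con 6 :* k) :* ((con 3 :+ con 6 :* k) :*
         ((con 2 :+ con 6 :* k) :* (con 1 :+ con 6 :* k))))) :* c :=
       con 3 :* ((con 3 :+ con 3 :* k) :* ((con 2 :+ con 3 :* k) :* (con 1 :+ con 3 :* k))) :*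
       (con 8 :* (con 1 :+ con 6 :* k) :* (con 1 :+ con 2 :* k) :* (con 5 :+ con 6 :* k) :* c)) refl k (6kC3k k))))
    where
    open ℕ.+-*-Solver
    instance _ = (3 * k) ℕ.!* (3 * k) !≢0

  -- In Pochhammer symbols, A k = 108ᵏ (1/3)ₖ(1/2)ₖ(2/3)ₖ/k!³ and B k = 1728ᵏ
  -- (1/6)ₖ(1/2)ₖ(5/6)ₖ/k!³.
  A B : ℕ → ℕ
  A k = 2kCk k * 2kCk k * 3kCk k
  B k = 2kCk k * 3kCk k * 6kC3k k

  -- One of the two factors 2(2k+1) from the squared central coefficient cancels against the
  -- denominator of the ratio of `3kCk`; the constant left is 2 · 3 = 6.
  A-suc : ∀ k → (1 + k) * ((1 + k) * (1 + k)) * A (suc k) ≡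
                6 * ((1 + 3 * k) * ((1 + 2 * k) * (2 + 3 * k))) * A k
  A-suc k = ℕ.*-cancelˡ-≡ _ _ (2 * (1 + 2 * k)) (trans
    (solve 3 (λ k c d → con 2 :* (con 1 :+ con 2 :* k) :* ((con 1 :+ k) :* ((con 1 :+ k) :* (con 1 :+ k)) :* (c :* c :* d)) :=
       (con 1 :+ k) :* c :* ((con 1 :+ k) :* c) :* (con 2 :* (con 1 :+ k) :* (con 1 :+ con 2 :* k) :* d))
       refl k (2kCk (suc k)) (3kCk (suc k)))
    (trans (cong₂ (λ u v → u * u * v) (2kCk-suc k) (3kCk-suc k))
    (solve 3 (λ k c d →
       con 2 :* (con 1 :+ con 2 :* k) :* c :* (con 2 :* (con 1 :+ con 2 :* k) :* c)
         :* (con 3 :* (con 1 :+ con 3 :* k) :* (con 2 :+ con 3 :* k) :* d) :=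
       con 2 :* (con 1 :+ con 2 :* k) :* (con 6 :* ((con 1 :+ con 3 :* k) :* ((con 1 :+ con 2 :* k) :* (con 2 :+ con 3 :* k)))
         :* (c :* c :* d))) refl k (2kCk k) (3kCk k))))
    where open ℕ.+-*-Solver

  B-suc : ∀ k → (1 + k) * ((1 + k) * (1 + k)) * B (suc k) ≡
                24 * ((1 + 6 * k) * ((1 + 2 * k) * (5 + 6 * k))) * B k
  B-suc k = ℕ.*-cancelˡ-≡ _ _ (2 * (1 + 2 * k) * ((1 + 3 * k) * (2 + 3 * k))) (trans
    (solve 4 (λ k c d e →
       con 2 :* (con 1 :+ con 2 :* k) :* ((con 1 :+ con 3 :* k) :* (con 2 :+ con 3 :* k)) :*
       ((con 1 :+ k) :* ((con 1 :+ k) :* (con 1 :+ k)) :* (c :* d :* e)) :=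
       (con 1 :+ k) :* c :* (con 2 :* (con 1 :+ k) :* (con 1 :+ con 2 :* k) :* d) :*
       ((con 1 :+ k) :* (con 1 :+ con 3 :* k) :* (con 2 :+ con 3 :* k) :* e))
       refl k (2kCk (suc k)) (3kCk (suc k)) (6kC3k (suc k)))
    (trans (cong₂ _*_ (cong₂ _*_ (2kCk-suc k) (3kCk-suc k)) (6kC3k-suc k))
    (solve 4 (λ k c d e →
       con 2 :* (con 1 :+ con 2 :* k) :* c :* (con 3 :* (con 1 :+ con 3 :* k) :* (con 2 :+ con 3 :* k) :* d) :*
       (con 8 :* (con 1 :+ con 6 :* k) :* (con 1 :+ con 2 :* k) :* (con 5 :+ con 6 :* k) :* e) :=
       con 2 :* (con 1 :+ con 2 :* k) :* ((con 1 :+ con 3 :* k) :* (con 2 :+ con 3 :* k)) :*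
       (con 24 :* ((con 1 :+ con 6 :* k) :* ((con 1 :+ con 2 :* k) :* (con 5 :+ con 6 :* k))) :* (c :* d :* e)))
       refl k (2kCk k) (3kCk k) (6kC3k k))))
    where open ℕ.+-*-Solver

  affine-pos : ∀ a b k → affine (+ a) (+ b) k ≡ + (a + b * k)
  affine-pos a b k = cong (λ n → + a ℤ.+ n) (sym (ℤ.pos-* b k))

  affine³-pos : ∀ a b c d e f k →
    affine (+ a) (+ b) k ℤ.* (affine (+ c) (+ d) k ℤ.* affine (+ e) (+ f) k) ≡
    + ((a + b * k) * ((c + d * k) * (e + f * k)))
  affine³-pos a b c d e f k = trans (cong₂ ℤ._*_ (affine-pos a b k)
      (trans (cong₂ ℤ._*_ (affine-pos c d k) (affine-pos e f k)) (sym (ℤ.pos-* (c + d * k) (e + f * k)))))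
    (sym (ℤ.pos-* (a + b * k) _))

  -- Attaching powers of c to a recurrence collects all constants in one factor u m c. In both uses
  -- u is 18; with m = 6 and c inverse to 108, or m = 24 and c inverse to 432, the factor is 1
  -- modulo p.
  scaled-recurrence : ∀ {a a′ r} (m n : ℕ) (u : ℤ) c cᵏ →
    n * (n * n) * a′ ≡ m * r * a →
    u ℤ.* (+ n ℤ.* (+ n ℤ.* + n)) ℤ.* (+ a′ ℤ.* (c ℤ.* cᵏ)) ≡ (u ℤ.* + m ℤ.* c) ℤ.* (+ r ℤ.* (+ a ℤ.* cᵏ))
  scaled-recurrence {a} {a′} {r} m n u c cᵏ eq = trans
    (solve 5 (λ u n a c d → u :* (n :* (n :* n)) :* (a :* (c :* d)) := n :* (n :* n) :* a :* (u :* c :* d))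
      refl u (+ n) (+ a′) c cᵏ)
    (trans (cong (ℤ._* (u ℤ.* c ℤ.* cᵏ)) cast)
    (solve 6 (λ m r a u c d → m :* r :* a :* (u :* c :* d) := (u :* m :* c) :* (r :* (a :* d)))
      refl (+ m) (+ r) (+ a) u c cᵏ))
    where
    open ℤ.+-*-Solver
    cast : + n ℤ.* (+ n ℤ.* + n) ℤ.* + a′ ≡ + m ℤ.* + r ℤ.* + a
    cast = trans (cong (ℤ._* + a′) (trans (cong (λ j → + n ℤ.* j) (sym (ℤ.pos-* n n))) (sym (ℤ.pos-* n (n * n)))))
      (trans (sym (ℤ.pos-* (n * (n * n)) a′)) (trans (cong +_ eq)
      (trans (ℤ.pos-* (m * r) a) (cong (ℤ._* + a) (ℤ.pos-* m r)))))

open BinomialProducts using (n∣n!; nCk*k![n-k]!≡n!; A; B; A-suc; B-suc; affine³-pos; scaled-recurrence)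

-- Fermat's theorem and Euler's criterion

module Modular (p : ℕ) where
  open ℤ.+-*-Solver using (solve; _:=_; _:+_; _:*_; _:-_; :-_)

  infix 4 _≈ₚ_
  record _≈ₚ_ (a b : ℤ) : Set where
    constructor congruent
    field difference : + p ℤ.∣ (a ℤ.- b)
  open _≈ₚ_ public

  private
    by : ∀ {a b} → a ≡ b → + p ℤ.∣ a → + p ℤ.∣ b
    by ≡.refl p∣a = p∣a

  ≡⇒≈ₚ : ∀ {a b} → a ≡ b → a ≈ₚ b
  ≡⇒≈ₚ {a} ≡.refl = congruent (by (≡.sym (ℤ.+-inverseʳ a)) (ℤ.divides (+ 0) ≡.refl))

  ≈ₚ-sym : ∀ {a b} → a ≈ₚ b → b ≈ₚ a
  ≈ₚ-sym {a} {b} (congruent d) =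
    congruent (by (solve 2 (λ a b → :- (a :- b) := b :- a) ≡.refl a b) (ℤ.∣m⇒∣-m d))

  ≈ₚ-trans : ∀ {a b c} → a ≈ₚ b → b ≈ₚ c → a ≈ₚ c
  ≈ₚ-trans {a} {b} {c} (congruent d) (congruent e) = congruent
    (by (solve 3 (λ a b c → (a :- b) :+ (b :- c) := a :- c) ≡.refl a b c) (ℤ.∣m∣n⇒∣m+n d e))

  ≈ₚ-+-cong : ∀ {a b c d} → a ≈ₚ b → c ≈ₚ d → a ℤ.+ c ≈ₚ b ℤ.+ d
  ≈ₚ-+-cong {a} {b} {c} {d} (congruent e) (congruent f) = congruent
    (by (solve 4 (λ a b c d → (a :- b) :+ (c :- d) := (a :+ c) :- (b :+ d)) ≡.refl a b c d) (ℤ.∣m∣n⇒∣m+n e f))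

  ≈ₚ-*-cong : ∀ {a b c d} → a ≈ₚ b → c ≈ₚ d → a ℤ.* c ≈ₚ b ℤ.* d
  ≈ₚ-*-cong {a} {b} {c} {d} (congruent e) (congruent f) = congruent
    (by (solve 4 (λ a b c d → (a :- b) :* c :+ b :* (c :- d) := a :* c :- b :* d) ≡.refl a b c d)
        (ℤ.∣m∣n⇒∣m+n (ℤ.∣m⇒∣m*n c e) (ℤ.∣n⇒∣m*n b f)))

  ≈ₚ-neg-cong : ∀ {a b} → a ≈ₚ b → ℤ.- a ≈ₚ ℤ.- b
  ≈ₚ-neg-cong {a} {b} (congruent d) = congruent
    (by (solve 2 (λ a b → :- (a :- b) := :- a :- :- b) ≡.refl a b) (ℤ.∣m⇒∣-m d))

  commutativeRing : CommutativeRing _ _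
  commutativeRing = record
    { Carrier = ℤ ; _≈_ = _≈ₚ_ ; _+_ = ℤ._+_ ; _*_ = ℤ._*_ ; -_ = ℤ.-_
    ; 0# = + 0 ; 1# = + 1
    ; isCommutativeRing = record
      { isRing = record
        { +-isAbelianGroup = record
          { isGroup = record
            { isMonoid = record
              { isSemigroup = record
                { isMagma = record
                  { isEquivalence = record { refl = ≡⇒≈ₚ ≡.refl ; sym = ≈ₚ-sym ; trans = ≈ₚ-trans }
                  ; ∙-cong = ≈ₚ-+-cong
                  }
                ; assoc = λ a b c → ≡⇒≈ₚ (ℤ.+-assoc a b c)
                }
              ; identity = ≡⇒≈ₚ ∘ ℤ.+-identityˡ , ≡⇒≈ₚ ∘ ℤ.+-identityʳ
              }
            ; inverse = ≡⇒≈ₚ ∘ ℤ.+-inverseˡ , ≡⇒≈ₚ ∘ ℤ.+-inverseʳ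
            ; ⁻¹-cong = ≈ₚ-neg-cong
            }
          ; comm = λ a b → ≡⇒≈ₚ (ℤ.+-comm a b)
          }
        ; *-cong = ≈ₚ-*-cong
        ; *-assoc = λ a b c → ≡⇒≈ₚ (ℤ.*-assoc a b c)
        ; *-identity = ≡⇒≈ₚ ∘ ℤ.*-identityˡ , ≡⇒≈ₚ ∘ ℤ.*-identityʳ
        ; distrib = (λ a b c → ≡⇒≈ₚ (ℤ.*-distribˡ-+ a b c)) , (λ a b c → ≡⇒≈ₚ (ℤ.*-distribʳ-+ a b c))
        }
      ; *-comm = λ a b → ≡⇒≈ₚ (ℤ.*-comm a b)
      }
    }

  integers : IntegersTo commutativeRing
  integers = record
    { ⟦_⟧    = λ n → n
    ; +-homo = λ _ _ → ≡⇒≈ₚ ≡.refl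
    ; *-homo = λ _ _ → ≡⇒≈ₚ ≡.refl
    ; -‿homo = λ _ → ≡⇒≈ₚ ≡.refl
    ; 0-homo = ≡⇒≈ₚ ≡.refl
    ; 1-homo = ≡⇒≈ₚ ≡.refl
    }

-- Inverses are not part of the structure: Fermat's theorem supplies them for integers prime to p,
-- and other nonzero elements are cancelled by integrality.
record IsDomainOfCharacteristic {c ℓ} (p : ℕ) (K : CommutativeRing c ℓ) (int : IntegersTo K) : Set (c ⊔ ℓ) where
  open IntegerAlgebra K int
  field
    ∣⇒≈0     : ∀ {n} → p ℕ.∣ ℤ.∣ n ∣ → ι n ≈ 0#
    ≈0⇒∣     : ∀ {n} → ι n ≈ 0# → p ℕ.∣ ℤ.∣ n ∣
    integral : ∀ {x y} → x * y ≈ 0# → x ≈ 0# ⊎ y ≈ 0#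

module Characteristic {c ℓ} (K : CommutativeRing c ℓ) (int : IntegersTo K) (p : ℕ) (p-prime : Prime p)
  (domain : IsDomainOfCharacteristic p K int) where
  open IsDomainOfCharacteristic domain public
  open IntegerAlgebra K int public
  open Reasoning
  open import Algebra.Properties.Monoid.Mult +-monoid using () renaming (_×_ to _·_)

  1<p : 1 ℕ.< p
  1<p = ℕ.nonTrivial⇒n>1 p {{prime⇒nonTrivial p-prime}}

  0<p : 0 ℕ.< p
  0<p = ℕ.<-trans ℕ.z<s 1<p

  *-≉0 : ∀ {x y} → x ≉ 0# → y ≉ 0# → x * y ≉ 0#
  *-≉0 x≉0 y≉0 xy≈0 with integral xy≈0
  ... | inj₁ x≈0 = x≉0 x≈0
  ... | inj₂ y≈0 = y≉0 y≈0

  x*y≈0⇒x≈0 : ∀ {x y} → y ≉ 0# → x * y ≈ 0# → x ≈ 0#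
  x*y≈0⇒x≈0 y≉0 xy≈0 with integral xy≈0
  ... | inj₁ x≈0 = x≈0
  ... | inj₂ y≈0 = ⊥-elim (y≉0 y≈0)

  *-cancelˡ : ∀ {x y z} → x ≉ 0# → x * y ≈ x * z → y ≈ z
  *-cancelˡ {x} {y} {z} x≉0 xy≈xz with integral {x} {y - z} (begin
    x * (y - z)   ≈⟨ solve 3 (λ a b c → a :* (b :- c) := a :* b :- a :* c) refl x y z ⟩
    x * y - x * z ≈⟨ x≈y⇒x∙y⁻¹≈ε xy≈xz ⟩
    0#            ∎)
  ... | inj₁ x≈0   = ⊥-elim (x≉0 x≈0)
  ... | inj₂ y-z≈0 = x∙y⁻¹≈ε⇒x≈y y z y-z≈0

  small≉0 : ∀ {n} → 0 ℕ.< n → n ℕ.< p → ι (+ n) ≉ 0#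
  small≉0 {suc n} _ n<p n≈0 = ℕ.<⇒≱ n<p (ℕ.∣⇒≤ (≈0⇒∣ n≈0))

  p≈0 : ι (+ p) ≈ 0#
  p≈0 = ∣⇒≈0 ℕ.∣-refl

  residue : ∀ n .{{_ : ℕ.NonZero p}} → ι n ≈ ι (+ (n ℤ.%ℕ p))
  residue n = begin
    ι n                                         ≡⟨ ≡.cong ι (ℤ.a≡a%ℕn+[a/ℕn]*n n p) ⟩
    ι (+ (n ℤ.%ℕ p) ℤ.+ (n ℤ./ℕ p) ℤ.* + p)     ≈⟨ trans (ι-+ _ _) (+-congˡ (ι-* _ _)) ⟩
    ι (+ (n ℤ.%ℕ p)) + ι (n ℤ./ℕ p) * ι (+ p)   ≈⟨ +-congˡ (trans (*-congˡ p≈0) (zeroʳ _)) ⟩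
    ι (+ (n ℤ.%ℕ p)) + 0#                       ≈⟨ +-identityʳ _ ⟩
    ι (+ (n ℤ.%ℕ p))                            ∎

  residue≡0 : ∀ n .{{_ : ℕ.NonZero p}} → ι n ≈ 0# → n ℤ.%ℕ p ≡ 0
  residue≡0 n n≈0 with n ℤ.%ℕ p in eq
  ... | zero  = ≡.refl
  ... | suc r = ⊥-elim (small≉0 {suc r} ℕ.z<s (≡.subst (ℕ._< p) eq (ℤ.n%ℕd<d n p))
    (trans (ι-≡ (≡.sym (≡.cong +_ eq))) (trans (sym (residue n)) n≈0)))

  ∤! : ∀ {n} → n ℕ.< p → ¬ p ℕ.∣ n !
  ∤! {zero}  _   p∣1 = ℕ.<⇒≱ 1<p (ℕ.∣⇒≤ p∣1)
  ∤! {suc n} n<p p∣n! with euclidsLemma (suc n) (n !) p-prime p∣n!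
  ... | inj₁ p∣1+n = ℕ.<⇒≱ n<p (ℕ.∣⇒≤ p∣1+n)
  ... | inj₂ p∣n   = ∤! (ℕ.<-trans (ℕ.n<1+n n) n<p) p∣n

  ∣pCk : ∀ {k} → 0 ℕ.< k → k ℕ.< p → p ℕ.∣ p C k
  ∣pCk {k} 0<k k<p with euclidsLemma (p C k) (k ! ℕ.* (p ℕ.∸ k) !) p-prime
    (≡.subst (p ℕ.∣_) (≡.sym (nCk*k![n-k]!≡n! (ℕ.<⇒≤ k<p))) (n∣n! 0<p))
  ... | inj₁ p∣pCk = p∣pCk
  ... | inj₂ p∣d with euclidsLemma (k !) ((p ℕ.∸ k) !) p-prime p∣d
  ...   | inj₁ p∣k!     = ⊥-elim (∤! k<p p∣k!)
  ...   | inj₂ p∣[p-k]! = ⊥-elim (∤! (ℕ.∸-monoʳ-< 0<k (ℕ.<⇒≤ k<p)) p∣[p-k]!)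

  p∣⇒·≈0 : ∀ {n} x → p ℕ.∣ n → n · x ≈ 0#
  p∣⇒·≈0 {n} x p∣n = trans (·≈* n x) (trans (*-congʳ (∣⇒≈0 p∣n)) (zeroˡ x))
    where
    ·≈* : ∀ n x → n · x ≈ ι (+ n) * x
    ·≈* zero    x = sym (trans (*-congʳ ι-0) (zeroˡ x))
    ·≈* (suc n) x = begin
      x + n · x                   ≈⟨ +-congˡ (·≈* n x) ⟩
      x + ι (+ n) * x             ≈⟨ solve 2 (λ n x → x :+ n :* x := (con (+ 1) :+ n) :* x) refl (ι (+ n)) x ⟩
      (ι (+ 1) + ι (+ n)) * x     ≈⟨ *-congʳ (ι-+ (+ 1) (+ n)) ⟨
      ι (+ suc n) * x             ∎

  freshman : ∀ x → (x + 1#) ^ p ≈ x ^ p + 1#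
  freshman x = go p ≡.refl
    where
    open import Algebra.Properties.CommutativeSemiring.Binomial commutativeSemiring using (theorem; binomialTerm)
    open import Algebra.Properties.Monoid.Sum +-monoid using (sum; sum-init-last; sum-cong-≋; sum-replicate-zero)
    open import Data.Vec.Functional using (init; last)
    open import Algebra.Properties.Monoid.Mult +-monoid using (×-homo-1)
    go : ∀ n → n ≡ p → (x + 1#) ^ n ≈ x ^ n + 1#
    go zero    ≡.refl = ⊥-elim (ℕ.<⇒≱ 1<p ℕ.z≤n)
    go (suc n) ≡.refl = begin
      (x + 1#) ^ suc n                                  ≈⟨ theorem (suc n) x 1# ⟩
      term Fin.zero + sum (term ∘ Fin.suc)              ≈⟨ +-cong first (sum-init-last (term ∘ Fin.suc)) ⟩
      1# + (sum (init (term ∘ Fin.suc)) + last (term ∘ Fin.suc))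
        ≈⟨ +-congˡ (+-cong (trans (sum-cong-≋ middle) (sum-replicate-zero n)) final) ⟩
      1# + (0# + x ^ suc n)                             ≈⟨ trans (+-congˡ (+-identityˡ _)) (+-comm _ _) ⟩
      x ^ suc n + 1#                                    ∎
      where
      term = binomialTerm x 1# (suc n)
      first : term Fin.zero ≈ 1#
      first = trans (×-homo-1 _) (trans (*-identityˡ _) (1#^n≈1# (suc n)))
      final : last (term ∘ Fin.suc) ≈ x ^ suc n
      final = ≡.subst (λ k → (suc n C suc k) · (x ^ suc k * 1# ^ (n ℕ.∸ k)) ≈ x ^ suc n)
        (≡.sym (Fin.toℕ-fromℕ n))
        (≡.subst (λ c → c · (x ^ suc n * 1# ^ (n ℕ.∸ n)) ≈ x ^ suc n) (≡.sym (nCn≡1 (suc n)))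
          (trans (×-homo-1 _) (trans (*-congˡ (1#^n≈1# (n ℕ.∸ n))) (*-identityʳ _))))
      middle : ∀ i → init (term ∘ Fin.suc) i ≈ 0#
      middle i = p∣⇒·≈0 _ (∣pCk ℕ.z<s (ℕ.s<s (≡.subst (ℕ._< n) (≡.sym (Fin.toℕ-inject₁ i)) (Fin.toℕ<n i))))

  -- The domain may be larger than its prime field, so the claim concerns images of integers.
  -- Induction by the binomial theorem covers natural numbers, and every integer is congruent to its
  -- residue.
  fermat : ∀ n → ι n ^ p ≈ ι n
  fermat n = begin
    ι n ^ p                  ≈⟨ ^-congˡ p (residue n) ⟩
    ι (+ (n ℤ.%ℕ p)) ^ p     ≈⟨ natural (n ℤ.%ℕ p) ⟩
    ι (+ (n ℤ.%ℕ p))         ≈⟨ residue n ⟨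
    ι n                      ∎
    where
    instance _ = ℕ.>-nonZero 0<p
    0^ : ∀ m → 0 ℕ.< m → ι (+ 0) ^ m ≈ ι (+ 0)
    0^ (suc m) _ = trans (trans (*-congʳ ι-0) (zeroˡ _)) (sym ι-0)
    natural : ∀ m → ι (+ m) ^ p ≈ ι (+ m)
    natural zero    = 0^ p 0<p
    natural (suc m) = begin
      ι (+ suc m) ^ p    ≈⟨ ^-congˡ p 1+m ⟩
      (ι (+ m) + 1#) ^ p ≈⟨ freshman (ι (+ m)) ⟩
      ι (+ m) ^ p + 1#   ≈⟨ +-congʳ (natural m) ⟩
      ι (+ m) + 1#       ≈⟨ 1+m ⟨
      ι (+ suc m)        ∎
      where
      1+m : ι (+ suc m) ≈ ι (+ m) + 1#
      1+m = trans (ι-+ (+ 1) (+ m)) (trans (+-congʳ ι-1) (+-comm _ _))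

  fermat′ : ∀ {x n} → suc n ≡ p → ι x ≉ 0# → ι x ^ n ≈ 1#
  fermat′ {x} ≡.refl x≉0 = *-cancelˡ x≉0 (trans (fermat x) (sym (*-identityʳ _)))

  -- Lower coefficients only, constant term first; the leading 1 is implicit. The degree is thus
  -- exactly the length of the vector and cannot degenerate.
  monic : ∀ {d} → Vec Carrier d → Carrier → Carrier
  monic []      x = 1#
  monic (a ∷ c) x = a + x * monic c x

  -- Synthetic division: the coefficients of the quotient are the intermediate values of Horner's
  -- scheme at a.
  monic-divide : ∀ {d} (c : Vec Carrier (suc d)) a →
    ∃ λ (e : Vec Carrier d) → ∀ x → monic c x ≈ monic c a + (x - a) * monic e x
  monic-divide {zero} (c₀ ∷ []) a = [] , λ x →
    solve 4 (λ c x a o → c :+ x :* o := (c :+ a :* o) :+ (x :- a) :* o) refl c₀ x a 1#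
  monic-divide {suc d} (c₀ ∷ c₁ ∷ c) a with monic-divide (c₁ ∷ c) a
  ... | e , divides = monic (c₁ ∷ c) a ∷ e , λ x → begin
    c₀ + x * monic (c₁ ∷ c) x
      ≈⟨ +-congˡ (*-congˡ (divides x)) ⟩
    c₀ + x * (monic (c₁ ∷ c) a + (x - a) * monic e x)
      ≈⟨ solve 5 (λ c x a m e → c :+ x :* (m :+ (x :- a) :* e) :=
           (c :+ a :* m) :+ (x :- a) :* (m :+ x :* e)) refl c₀ x a (monic (c₁ ∷ c) a) (monic e x) ⟩
    monic (c₀ ∷ c₁ ∷ c) a + (x - a) * monic (monic (c₁ ∷ c) a ∷ e) x ∎

  -- Dividing by x - x₀ lowers the degree, and by integrality the other points stay roots of the
  -- quotient. In degree 0 the constant 1 would have a root.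
  no-excess-roots : ∀ {d} (c : Vec Carrier d) (x : ℕ → Carrier) →
    (∀ i → i ℕ.≤ d → monic c (x i) ≈ 0#) → (∀ {i j} → i ℕ.< j → j ℕ.≤ d → x j ≉ x i) → ⊥
  no-excess-roots []      x root distinct = small≉0 ℕ.z<s 1<p (trans ι-1 (root 0 ℕ.z≤n))
  no-excess-roots (a ∷ c) x root distinct with monic-divide (a ∷ c) (x 0)
  ... | e , divides = no-excess-roots e (x ∘ suc)
    (λ i i≤d → case integral (begin
        (x (suc i) - x 0) * monic e (x (suc i))                     ≈⟨ +-identityˡ _ ⟨
        0# + (x (suc i) - x 0) * monic e (x (suc i))                ≈⟨ +-congʳ (root 0 ℕ.z≤n) ⟨
        monic (a ∷ c) (x 0) + (x (suc i) - x 0) * monic e (x (suc i)) ≈⟨ divides (x (suc i)) ⟨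
        monic (a ∷ c) (x (suc i))                                   ≈⟨ root (suc i) (ℕ.s≤s i≤d) ⟩
        0#                                                          ∎) of λ
      { (inj₁ eq) → ⊥-elim (distinct ℕ.z<s (ℕ.s≤s i≤d) (x∙y⁻¹≈ε⇒x≈y _ _ eq))
      ; (inj₂ eq) → eq })
    (λ i<j j≤d → distinct (ℕ.s<s i<j) (ℕ.s≤s j≤d))

  -- Squares of 1, …, h are h roots of xʰ − 1; a non-residue n with nʰ = 1 would be one root too many.
  euler : ∀ .{{_ : ℕ.NonZero p}} h → p ≡ suc (h ℕ.+ h) → ∀ n → ι (legendre p n) ≈ ι n ^ h
  euler zero    p≡1 n = ⊥-elim (ℕ.<-irrefl (≡.sym p≡1) 1<p)
  euler h@(suc h-1) p≡2h+1 n with (n ℤ.%ℕ p) ℕ.≡ᵇ 0 in n%p | any (λ x → (+ x ℤ.* + x ℤ.- n) ℤ.%ℕ p ℕ.≡ᵇ 0) (upTo p) in squares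
  ... | true | _ = begin
      ι (+ 0)            ≈⟨ ι-0 ⟩
      0#                 ≈⟨ zeroˡ _ ⟨
      0# * ι n ^ h-1     ≈⟨ *-congʳ n≈0 ⟨
      ι n ^ h            ∎
    where
    n≈0 : ι n ≈ 0#
    n≈0 = trans (residue n) (trans (ι-≡ (≡.cong +_ (ℕ.≡ᵇ⇒≡ _ 0 (≡.subst T (≡.sym n%p) tt)))) ι-0)
  ... | false | true = begin
      ι (+ 1)             ≈⟨ ι-1 ⟩
      1#                  ≈⟨ fermat′ (≡.sym p≡2h+1) x≉0 ⟨
      ι (+ x) ^ (h ℕ.+ h) ≈⟨ trans (^-homo-* (ι (+ x)) h h) (sym (^-distrib-* _ _ h)) ⟩
      (ι (+ x) * ι (+ x)) ^ h ≈⟨ ^-congˡ h (trans (sym (ι-* _ _)) x²≈n) ⟩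
      ι n ^ h             ∎
    where
    root : ∃ λ x → T ((+ x ℤ.* + x ℤ.- n) ℤ.%ℕ p ℕ.≡ᵇ 0)
    root = Any.satisfied (Any.any⁻ _ (upTo p) (≡.subst T (≡.sym squares) tt))
    x = proj₁ root
    x²≈n : ι (+ x ℤ.* + x) ≈ ι n
    x²≈n = x∙y⁻¹≈ε⇒x≈y _ _ (begin
      ι (+ x ℤ.* + x) - ι n                      ≈⟨ trans (ι-+ _ _) (+-congˡ (ι-neg n)) ⟨
      ι (+ x ℤ.* + x ℤ.- n)                      ≈⟨ residue _ ⟩
      ι (+ ((+ x ℤ.* + x ℤ.- n) ℤ.%ℕ p))         ≡⟨ ≡.cong (λ m → ι (+ m)) (ℕ.≡ᵇ⇒≡ _ 0 (proj₂ root)) ⟩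
      ι (+ 0)                                    ≈⟨ ι-0 ⟩
      0#                                         ∎)
    x≉0 : ι (+ x) ≉ 0#
    x≉0 x≈0 = ≡.subst T n%p (ℕ.≡⇒≡ᵇ _ 0 (residue≡0 n
      (trans (sym x²≈n) (trans (ι-* _ _) (trans (*-congʳ x≈0) (zeroˡ _))))))
  ... | false | false = sym (case integral {ι n ^ h - 1#} {ι n ^ h + 1#} (begin
      (ι n ^ h - 1#) * (ι n ^ h + 1#)
        ≈⟨ solve 2 (λ y o → (y :- o) :* (y :+ o) := y :* y :- o :* o) refl (ι n ^ h) 1# ⟩
      ι n ^ h * ι n ^ h - 1# * 1#
        ≈⟨ +-cong (trans (sym (^-homo-* (ι n) h h)) (fermat′ (≡.sym p≡2h+1) n≉0)) (-‿cong (*-identityˡ 1#)) ⟩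
      1# - 1# ≈⟨ -‿inverseʳ 1# ⟩
      0# ∎) of λ
      -- The vector encodes xʰ - 1.
      { (inj₁ nʰ-1≈0) → ⊥-elim (no-excess-roots (- 1# ∷ replicate h-1 0#) root (isRoot nʰ-1≈0) distinct)
      ; (inj₂ nʰ+1≈0) → trans (x∙y⁻¹≈ε⇒x≈y (ι n ^ h) (- 1#) (trans (+-congˡ (-‿involutive 1#)) nʰ+1≈0))
                          (sym (trans (ι-neg (+ 1)) (-‿cong ι-1))) })
    where
    open import Algebra.Properties.Ring ring using (-‿involutive)
    n≉0 : ι n ≉ 0#
    n≉0 n≈0 = ≡.subst T n%p (ℕ.≡⇒≡ᵇ _ 0 (residue≡0 n n≈0))
    2h<p : h ℕ.+ h ℕ.< p
    2h<p = ℕ.≤-reflexive (≡.sym p≡2h+1)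
    square : ℕ → Carrier
    square i = ι (+ i) * ι (+ i)
    root : ℕ → Carrier
    root zero    = ι n
    root (suc i) = square (suc i)
    square≉n : ∀ i → i ℕ.< p → square i ≉ ι n
    square≉n i i<p i²≈n = ≡.subst T squares (Any.any⁺ _ (lose (∈-upTo⁺ i<p)
      (ℕ.≡⇒≡ᵇ _ 0 (residue≡0 (+ i ℤ.* + i ℤ.- n)
        (trans (ι-+ _ _) (trans (+-cong (ι-* _ _) (ι-neg n)) (x≈y⇒x∙y⁻¹≈ε i²≈n)))))))
    monic-xᵈ : ∀ d x → monic (replicate d 0#) x ≈ x ^ d
    monic-xᵈ zero    x = refl
    monic-xᵈ (suc d) x = trans (+-identityˡ _) (*-congˡ (monic-xᵈ d x))
    isRoot : ι n ^ h - 1# ≈ 0# → ∀ i → i ℕ.≤ h → monic (- 1# ∷ replicate h-1 0#) (root i) ≈ 0#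
    isRoot nʰ-1≈0 i i≤h = trans (+-congˡ (*-congˡ (monic-xᵈ h-1 (root i))))
      (trans (+-comm _ _) (go i i≤h))
      where
      go : ∀ i → i ℕ.≤ h → root i ^ h - 1# ≈ 0#
      go zero    _   = nʰ-1≈0
      go (suc i) i<h = x≈y⇒x∙y⁻¹≈ε (begin
        square (suc i) ^ h                    ≈⟨ ^-distrib-* _ _ h ⟩
        ι (+ suc i) ^ h * ι (+ suc i) ^ h     ≈⟨ ^-homo-* (ι (+ suc i)) h h ⟨
        ι (+ suc i) ^ (h ℕ.+ h)               ≈⟨ fermat′ (≡.sym p≡2h+1)
          (small≉0 ℕ.z<s (ℕ.≤-<-trans (ℕ.≤-trans i<h (ℕ.m≤m+n h h)) 2h<p)) ⟩
        1#                                    ∎)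
    distinct : ∀ {i j} → i ℕ.< j → j ℕ.≤ h → root j ≉ root i
    distinct {zero}  {suc j} _   j≤h eq = square≉n (suc j)
      (ℕ.≤-<-trans (ℕ.≤-trans j≤h (ℕ.m≤m+n h h)) 2h<p) eq
    -- j² - i² = (j - i)(j + i), and both factors lie strictly between 0 and p because i < j ≤ h and
    -- 2h < p.
    distinct {suc i} {suc j} i<j j≤h eq with integral {ι (+ suc j) - ι (+ suc i)} {ι (+ suc j) + ι (+ suc i)} (trans
      (solve 2 (λ x y → (x :- y) :* (x :+ y) := x :* x :- y :* y) refl _ _) (x≈y⇒x∙y⁻¹≈ε eq))
    ... | inj₂ j+i≈0 = small≉0 {suc j ℕ.+ suc i} ℕ.z<s
      (ℕ.≤-<-trans (ℕ.+-mono-≤ j≤h (ℕ.≤-trans (ℕ.<⇒≤ i<j) j≤h)) 2h<p) (trans (ι-+ (+ suc j) (+ suc i)) j+i≈0)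
    ... | inj₁ j-i≈0 = small≉0 {suc j ℕ.∸ suc i} (ℕ.m<n⇒0<n∸m i<j)
      (ℕ.≤-<-trans (ℕ.≤-trans (ℕ.m∸n≤m (suc j) (suc i)) (ℕ.≤-trans j≤h (ℕ.m≤m+n h h))) 2h<p)
      (begin
        ι (+ (suc j ℕ.∸ suc i)) ≡⟨ ≡.cong ι (≡.sym (≡.trans (ℤ.m-n≡m⊖n (suc j) (suc i)) (ℤ.⊖-≥ (ℕ.<⇒≤ i<j)))) ⟩
        ι (+ suc j ℤ.- + suc i) ≈⟨ trans (ι-+ (+ suc j) (ℤ.- + suc i)) (+-congˡ (ι-neg (+ suc i))) ⟩
        ι (+ suc j) - ι (+ suc i) ≈⟨ j-i≈0 ⟩
        0# ∎)

-- The transformation formula over a domain of characteristic p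

module Transformation {c ℓ} (K : CommutativeRing c ℓ) (int : IntegersTo K) (p : ℕ) (p-prime : Prime p)
  (domain : IsDomainOfCharacteristic p K int) (3<p : 3 ℕ.< p) where

  open Characteristic K int p p-prime domain
  open Reasoning
  private
    module PS = PowerSeries K int
    module S = IntegerAlgebra PS.commutativeRing PS.integers
  open PS using (Series; X; coefficient; coefficientwise; X^_∣_)

  derivation : Derivation PS.commutativeRing PS.integers
  derivation = record
    { θ = PS.θ ; θ-cong = PS.θ-cong ; θ-+ = PS.θ-+ ; leibniz = PS.leibniz ; θ-ι = PS.θ-ι }

  private module LS = LegendreSquare PS.commutativeRing PS.integers derivation X PS.θ-X

  2≉0 : ι (+ 2) ≉ 0#
  2≉0 = small≉0 ℕ.z<s (ℕ.<-trans (ℕ.n<1+n 2) 3<p)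

  3≉0 : ι (+ 3) ≉ 0#
  3≉0 = small≉0 ℕ.z<s 3<p

  -- If f vanishes below index n, then coefficient n of `multiplier` times L f is 16 · 36 n³ times
  -- that of f, since every coefficient of `L` other than that of θ³ is a multiple of s. The
  -- recurrence therefore forces one coefficient after another to vanish, up to index p - 1.
  L-uniqueness : ∀ (f : Series) → f 0 ≈ 0# → LS.multiplier S.* LS.L f S.≈ S.0# → X^ p ∣ f
  L-uniqueness f f₀≈0 Lf≈0 = divisible p ℕ.≤-refl
    where
    lead : Carrier
    lead = ι (+ 9) * ((ι (+ 2) - 0#) * (ι (+ 2) - 0#))
    2-0≉0 : ι (+ 2) - 0# ≉ 0#
    2-0≉0 eq = 2≉0 (x∙y⁻¹≈ε⇒x≈y _ _ eq)
    1+4*0≉0 : ι (+ 1) + ι (+ 4) * 0# ≉ 0#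
    1+4*0≉0 eq = small≉0 ℕ.z<s 1<p (trans (sym (trans (+-congˡ (zeroʳ _)) (+-identityʳ _))) eq)
    lead≉0 : lead ≉ 0#
    lead≉0 = *-≉0 (λ 9≈0 → *-≉0 3≉0 3≉0 (trans (sym (ι-* (+ 3) (+ 3))) 9≈0)) (*-≉0 2-0≉0 2-0≉0)
    multiplier≉0 : LS.multiplier 0 ≉ 0#
    multiplier≉0 = *-≉0 (*-≉0 q≉0 (*-≉0 q≉0 q≉0)) 2-0≉0
      where
      q≉0 : (ι (+ 2) - 0#) * (ι (+ 1) + ι (+ 4) * 0#) ≉ 0#
      q≉0 = *-≉0 2-0≉0 1+4*0≉0
    L-coefficient : ∀ n → X^ n ∣ f →
      LS.L f n ≈ lead * (ι (+ n) * (ι (+ n) * (ι (+ n) * f n)))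
    L-coefficient n n∣f = begin
      LS.L f n
        ≈⟨ +-cong (+-cong (+-cong (PS.*-coefficient _ _ (PS.X^∣-θ (PS.X^∣-θ (PS.X^∣-θ n∣f))))
             (PS.*-coefficient _ _ (PS.X^∣-θ (PS.X^∣-θ n∣f)))) (PS.*-coefficient _ _ (PS.X^∣-θ n∣f)))
             (PS.*-coefficient _ _ n∣f) ⟩
      -- The coefficients of θ², θ and 1 in `L` have constant term 0.
      _ ≈⟨ +-cong (+-cong (+-congˡ (lower _ _)) (lower _ _)) (lower _ _) ⟩
      lead * (ι (+ n) * (ι (+ n) * (ι (+ n) * f n))) + 0# + 0# + 0#
        ≈⟨ trans (+-identityʳ _) (trans (+-identityʳ _) (+-identityʳ _)) ⟩
      lead * (ι (+ n) * (ι (+ n) * (ι (+ n) * f n))) ∎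
      where
      lower : ∀ x y → 0# * x * y ≈ 0#
      lower x y = trans (*-congʳ (zeroˡ x)) (zeroˡ y)
    step : ∀ n → n ℕ.< p → X^ n ∣ f → f n ≈ 0#
    step zero    _   _   = f₀≈0
    step (suc n) n<p n∣f = *-cancelˡ (*-≉0 (*-≉0 multiplier≉0 lead≉0) (*-≉0 n≉0 (*-≉0 n≉0 n≉0))) (begin
      (LS.multiplier 0 * lead) * (N * (N * N)) * f (suc n)
        ≈⟨ solve 4 (λ m l n x → (m :* l) :* (n :* (n :* n)) :* x := m :* (l :* (n :* (n :* (n :* x)))))
             refl (LS.multiplier 0) lead N (f (suc n)) ⟩
      LS.multiplier 0 * (lead * (N * (N * (N * f (suc n)))))
        ≈⟨ *-congˡ (L-coefficient (suc n) n∣f) ⟨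
      LS.multiplier 0 * LS.L f (suc n)
        ≈⟨ PS.*-coefficient LS.multiplier (LS.L f) L∣ ⟨
      (LS.multiplier S.* LS.L f) (suc n) ≈⟨ coefficient Lf≈0 (suc n) ⟩
      0# ≈⟨ zeroʳ _ ⟨
      (LS.multiplier 0 * lead) * (N * (N * N)) * 0# ∎)
      where
      N = ι (+ suc n)
      n≉0 : N ≉ 0#
      n≉0 = small≉0 ℕ.z<s n<p
      L∣ : X^ suc n ∣ LS.L f
      L∣ = PS.X^∣-+ (PS.X^∣-+ (PS.X^∣-+ (PS.X^∣-* _ (PS.X^∣-θ (PS.X^∣-θ (PS.X^∣-θ n∣f))))
        (PS.X^∣-* _ (PS.X^∣-θ (PS.X^∣-θ n∣f)))) (PS.X^∣-* _ (PS.X^∣-θ n∣f))) (PS.X^∣-* _ n∣f)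
    divisible : ∀ n → n ℕ.≤ p → X^ n ∣ f
    divisible (suc n) n<p k k<1+n with ℕ.m<1+n⇒m<n∨m≡n k<1+n
    ... | inj₁ k<n    = divisible n (ℕ.<⇒≤ n<p) k k<n
    ... | inj₂ ≡.refl = step n n<p (divisible n (ℕ.<⇒≤ n<p))

  module _ (h : ℕ) (p≡2h+1 : p ≡ suc (h ℕ.+ h)) where

    2h+1≈0 : S.ι (+ 2) S.* S.ι (+ h) S.+ S.ι (+ 1) S.≈ S.0#
    2h+1≈0 = S.trans (S.+-congʳ (S.sym (S.ι-* (+ 2) (+ h)))) (S.trans (S.sym (S.ι-+ (+ 2 ℤ.* + h) (+ 1)))
      (S.trans (PS.const-cong (trans (ι-≡ eq) p≈0)) (coefficientwise λ { zero → refl ; (suc n) → refl })))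
      where
      eq : + 2 ℤ.* + h ℤ.+ + 1 ≡ + p
      eq = ≡.trans (≡.cong (ℤ._+ + 1) (≡.sym (ℤ.pos-* 2 h))) (≡.cong +_ (≡.trans (ℕ.+-comm (2 ℕ.* h) 1)
        (≡.trans (≡.cong (λ m → suc (h ℕ.+ m)) (ℕ.+-identityʳ h)) (≡.sym p≡2h+1))))

    module _ (u v : ℤ) (108u≈1 : ι (+ 108 ℤ.* u) ≈ 1#) (432v≈1 : ι (+ 432 ℤ.* v) ≈ 1#) where

      α β : ℕ → ℤ
      α k = + A k ℤ.* u ℤ.^ k
      β k = + B k ℤ.* v ℤ.^ k

      α-recurrence : ∀ k → ι (+ 18 ℤ.* (+ suc k ℤ.* (+ suc k ℤ.* + suc k)) ℤ.* α (suc k)) ≈ ι (r₁ k ℤ.* α k)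
      α-recurrence k = trans (ι-≡ (scaled-recurrence {a = A k} {A (suc k)} {r = (1 ℕ.+ 3 ℕ.* k) ℕ.* ((1 ℕ.+ 2 ℕ.* k) ℕ.* (2 ℕ.+ 3 ℕ.* k))} 6 (suc k) (+ 18) u (u ℤ.^ k) (A-suc k)))
        (trans (ι-* _ _) (trans (*-congʳ 108u≈1) (trans (*-identityˡ _)
          (ι-≡ (≡.cong (ℤ._* α k) (≡.sym (affine³-pos 1 3 1 2 2 3 k)))))))

      β-recurrence : ∀ k → ι (+ 18 ℤ.* (+ suc k ℤ.* (+ suc k ℤ.* + suc k)) ℤ.* β (suc k)) ≈ ι (r₂ k ℤ.* β k)
      β-recurrence k = trans (ι-≡ (scaled-recurrence {a = B k} {B (suc k)} {r = (1 ℕ.+ 6 ℕ.* k) ℕ.* ((1 ℕ.+ 2 ℕ.* k) ℕ.* (5 ℕ.+ 6 ℕ.* k))} 24 (suc k) (+ 18) v (v ℤ.^ k) (B-suc k)))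
        (trans (ι-* _ _) (trans (*-congʳ 432v≈1) (trans (*-identityˡ _)
          (ι-≡ (≡.cong (ℤ._* β k) (≡.sym (affine³-pos 1 6 1 2 5 6 k)))))))

      module _ (n : ℕ) (3n≤h : 3 ℕ.* n ℕ.≤ h) (r₂n≈0 : ι (r₂ n) ≈ 0#) where

        F G : Series
        F = S.∑ h (λ k → S.ι (α k) S.* (X S.* LS.2-s) S.^ k)
        G = S.∑ n (λ k → S.ι (β k) S.* (LS.Z S.^ k S.* LS.1+4s S.^ (h ℕ.∸ 3 ℕ.* k)))

        difference-annihilated : LS.multiplier S.* LS.L (F S.+ S.ι -[1+ 0 ] S.* G) S.≈ S.0#
        difference-annihilated = S.trans (S.*-congˡ (S.trans (LS.L-+ _ _) (S.+-congˡ (LS.L-scale G (PS.θ-ι _)))))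
          (S.trans (S.solve 4 (λ m l e l′ → m S.:* (l S.:+ e S.:* l′) S.:= m S.:* l S.:+ e S.:* (m S.:* l′))
             S.refl LS.multiplier (LS.L F) (S.ι -[1+ 0 ]) (LS.L G))
          (S.trans (S.+-cong (LS.hypergeometric₁-annihilated h 2h+1≈0 α (λ k → PS.const-cong (α-recurrence k)))
             (S.trans (S.*-congˡ (LS.hypergeometric₂-annihilated h 2h+1≈0 β n 3n≤h
               (λ k → PS.const-cong (β-recurrence k)) (S.trans (PS.const-cong r₂n≈0)
                 (coefficientwise λ { zero → refl ; (suc n) → refl })))) (S.zeroʳ _)))
          (S.+-identityˡ _)))

        ∑-constantTerm : ∀ n (f : ℕ → Series) → (∀ k → f (suc k) 0 ≈ 0#) → S.∑ n f 0 ≈ f 0 0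
        ∑-constantTerm zero    f _  = refl
        ∑-constantTerm (suc n) f f₀ = trans (+-cong (∑-constantTerm n f f₀) (f₀ n)) (+-identityʳ _)

        F₀≈1 : F 0 ≈ 1#
        F₀≈1 = trans (∑-constantTerm h _ λ k → trans (*-congˡ (trans (*-congʳ (zeroˡ _)) (zeroˡ _))) (zeroʳ _))
          (trans (*-identityʳ _) ι-1)

        G₀≈1 : G 0 ≈ 1#
        G₀≈1 = trans (∑-constantTerm n _ λ k →
            trans (*-congˡ (trans (*-congʳ (trans (*-congʳ (zeroˡ _)) (zeroˡ _))) (zeroˡ _))) (zeroʳ _))
          (trans (*-cong ι-1 (trans (*-identityˡ _) (one^ h))) (*-identityˡ _))
          where
          one^ : ∀ j → (LS.1+4s S.^ j) 0 ≈ 1#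
          one^ zero    = refl
          one^ (suc j) = trans (*-cong (trans (+-cong ι-1 (zeroʳ _)) (+-identityʳ _)) (one^ j)) (*-identityˡ _)

        module _ (x : Carrier) where
          open PS.Evaluation x

          two-x four-x : Carrier
          two-x = ι (+ 2) - x
          four-x = ι (+ 1) + ι (+ 4) * x

          -- The difference F - G has degree at most 2h and is divisible by X^p with p = 2h + 1, so
          -- it vanishes and so does its value at x.
          transformation : ∑ h (λ k → ι (α k) * (x * two-x) ^ k) ≈
            ∑ n (λ k → ι (β k) * ((x * (two-x * (two-x * two-x))) ^ k * four-x ^ (h ℕ.∸ 3 ℕ.* k)))
          transformation = x∙y⁻¹≈ε⇒x≈y _ _ (trans
            (solve 2 (λ a b → a :- b := a :+ con -[1+ 0 ] :* b) refl _ _)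
            (vanishing (add polyF (mul {d = 0} (integer -[1+ 0 ]) polyG)) (≡.subst (λ m → X^ m ∣ (F S.+ S.ι -[1+ 0 ] S.* G)) p≡2h+1
              (L-uniqueness _ D₀≈0 difference-annihilated))))
            where
            D₀≈0 : F 0 + ι -[1+ 0 ] * G 0 ≈ 0#
            D₀≈0 = trans (+-cong F₀≈1 (*-congˡ G₀≈1)) (trans
              (solve 1 (λ o → o :+ con -[1+ 0 ] :* o := con (+ 0)) refl 1#) ι-0)
            poly-2-s : Poly 1 LS.2-s two-x
            poly-2-s = resp
              (S.solve 1 (λ s → S.con (+ 2) S.:+ S.con -[1+ 0 ] S.:* s S.:= S.con (+ 2) S.:- s) S.refl X)
              (solve 1 (λ s → con (+ 2) :+ con -[1+ 0 ] :* s := con (+ 2) :- s) refl x)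
              (add (integer (+ 2)) (mul {d = 0} (integer -[1+ 0 ]) variable-X))
            poly-1+4s : Poly 1 LS.1+4s four-x
            poly-1+4s = add (integer (+ 1)) (mul {d = 0} (integer (+ 4)) variable-X)
            polyF : Poly (h ℕ.+ h) F (∑ h (λ k → ι (α k) * (x * two-x) ^ k))
            polyF = sum h λ k k≤h → mul {d = 0} (integer (α k))
              (weaken (ℕ.≤-trans (ℕ.*-monoˡ-≤ 2 k≤h) (ℕ.≤-reflexive (h*2≡h+h))) (power k (mul variable-X poly-2-s)))
              where
              h*2≡h+h : h ℕ.* 2 ≡ h ℕ.+ h
              h*2≡h+h = ≡.trans (ℕ.*-comm h 2) (≡.cong (h ℕ.+_) (ℕ.+-identityʳ h))
            polyG : Poly (h ℕ.+ h) G
              (∑ n (λ k → ι (β k) * ((x * (two-x * (two-x * two-x))) ^ k * four-x ^ (h ℕ.∸ 3 ℕ.* k))))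
            polyG = sum n λ k k≤n → mul {d = 0} (integer (β k)) (weaken (degree k k≤n)
              (mul (power k (mul variable-X (mul poly-2-s (mul poly-2-s poly-2-s))))
                   (power (h ℕ.∸ 3 ℕ.* k) poly-1+4s)))
              where
              -- 4k + (h - 3k) = h + k, and k ≤ 3k ≤ h.
              degree : ∀ k → k ℕ.≤ n → k ℕ.* 4 ℕ.+ (h ℕ.∸ 3 ℕ.* k) ℕ.* 1 ℕ.≤ h ℕ.+ h
              degree k k≤n = ℕ.≤-trans (ℕ.≤-reflexive (≡.trans
                (≡.cong₂ ℕ._+_ k*4≡k+3k (ℕ.*-identityʳ _))
                (≡.trans (ℕ.+-assoc k (3 ℕ.* k) _) (≡.cong (k ℕ.+_) (ℕ.m+[n∸m]≡n 3k≤h)))))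
                (ℕ.+-monoˡ-≤ h (ℕ.≤-trans (ℕ.m≤m+n k _) 3k≤h))
                where
                3k≤h : 3 ℕ.* k ℕ.≤ h
                3k≤h = ℕ.≤-trans (ℕ.*-monoʳ-≤ 3 k≤n) 3n≤h
                k*4≡k+3k : k ℕ.* 4 ≡ k ℕ.+ 3 ℕ.* k
                k*4≡k+3k = ℕ.*-comm k 4

-- Reduction of rational numbers modulo p

toℚᵘ-ℤ→ℚ : ∀ n → toℚᵘ (ℤ→ℚ n) ℚᵘ.≃ mkℚᵘ n 0
toℚᵘ-ℤ→ℚ n = ℚ.toℚᵘ-fromℚᵘ (mkℚᵘ n 0)

ℤ→ℚ-injective : ∀ {m n} → ℤ→ℚ m ≡ ℤ→ℚ n → m ≡ n
ℤ→ℚ-injective {m} {n} eq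
  with ℚᵘ.≃-trans (ℚᵘ.≃-sym (toℚᵘ-ℤ→ℚ m)) (ℚᵘ.≃-trans (ℚᵘ.≃-reflexive (≡.cong toℚᵘ eq)) (toℚᵘ-ℤ→ℚ n))
... | *≡* m*1≡n*1 = ≡.trans (≡.sym (ℤ.*-identityʳ m)) (≡.trans m*1≡n*1 (ℤ.*-identityʳ n))

ℤ→ℚ-+ : ∀ m n → ℤ→ℚ (m ℤ.+ n) ≡ ℤ→ℚ m ℚ.+ ℤ→ℚ n
ℤ→ℚ-+ m n = ℚ.toℚᵘ-injective (ℚᵘ.≃-trans (toℚᵘ-ℤ→ℚ (m ℤ.+ n)) (ℚᵘ.≃-trans
  (*≡* (≡.cong (ℤ._* + 1) (≡.sym (≡.cong₂ ℤ._+_ (ℤ.*-identityʳ m) (ℤ.*-identityʳ n)))))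
  (ℚᵘ.≃-sym (ℚᵘ.≃-trans (ℚ.toℚᵘ-homo-+ (ℤ→ℚ m) (ℤ→ℚ n)) (ℚᵘ.+-cong (toℚᵘ-ℤ→ℚ m) (toℚᵘ-ℤ→ℚ n))))))

ℤ→ℚ-* : ∀ m n → ℤ→ℚ (m ℤ.* n) ≡ ℤ→ℚ m ℚ.* ℤ→ℚ n
ℤ→ℚ-* m n = ℚ.toℚᵘ-injective (ℚᵘ.≃-trans (toℚᵘ-ℤ→ℚ (m ℤ.* n)) (ℚᵘ.≃-trans (*≡* ≡.refl)
  (ℚᵘ.≃-sym (ℚᵘ.≃-trans (ℚ.toℚᵘ-homo-* (ℤ→ℚ m) (ℤ→ℚ n)) (ℚᵘ.*-cong (toℚᵘ-ℤ→ℚ m) (toℚᵘ-ℤ→ℚ n))))))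

ℤ→ℚ-neg : ∀ n → ℤ→ℚ (ℤ.- n) ≡ ℚ.- ℤ→ℚ n
ℤ→ℚ-neg n = ℚ.toℚᵘ-injective (ℚᵘ.≃-trans (toℚᵘ-ℤ→ℚ (ℤ.- n))
  (ℚᵘ.≃-sym (ℚᵘ.≃-trans (ℚ.toℚᵘ-homo‿- (ℤ→ℚ n)) (ℚᵘ.-‿cong (toℚᵘ-ℤ→ℚ n)))))

*-denominator : ∀ q → q ℚ.* ℤ→ℚ (ℚ.denominator q) ≡ ℤ→ℚ (ℚ.numerator q)
*-denominator q@(mkℚ n d-1 _) = ℚ.toℚᵘ-injective (ℚᵘ.≃-trans (ℚ.toℚᵘ-homo-* q (ℤ→ℚ (+ suc d-1)))
  (ℚᵘ.≃-trans (ℚᵘ.*-congˡ {toℚᵘ q} (toℚᵘ-ℤ→ℚ (+ suc d-1))) (ℚᵘ.≃-trans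
    (*≡* (≡.trans (ℤ.*-identityʳ _) (≡.cong (λ m → n ℤ.* + m) (≡.sym (ℕ.*-identityʳ (suc d-1))))))
    (ℚᵘ.≃-sym (toℚᵘ-ℤ→ℚ n)))))

inv-inverseˡ : ∀ q → ℚ.numerator q ≢ + 0 → inv q ℚ.* q ≡ 1ℚ
inv-inverseˡ q@(mkℚ (+ zero) _ _) n≢0 = ⊥-elim (n≢0 ≡.refl)
inv-inverseˡ q@(mkℚ +[1+ n ] _ _) _   = ℚ.*-inverseˡ q
inv-inverseˡ q@(mkℚ -[1+ n ] _ _) _   = ℚ.*-inverseˡ q

lowestTerms : ∀ q {d} → d ℕ.∣ ℤ.∣ ℚ.numerator q ∣ → d ℕ.∣ ℚ.denominatorℕ q → d ≡ 1
lowestTerms (mkℚ _ _ coprime) {d} d∣n d∣d′ = recompute (d ℕ.≟ 1) (coprime (d∣n , d∣d′))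

module Reduction {c ℓ} (K : CommutativeRing c ℓ) (int : IntegersTo K) (p : ℕ) (p-prime : Prime p)
  (domain : IsDomainOfCharacteristic p K int) where
  open Characteristic K int p p-prime domain

  -- Reduction modulo p; the fraction numer / denom for q need not be in lowest terms.
  infix 4 _↦_
  record _↦_ (q : ℚ) (x : Carrier) : Set (c ⊔ ℓ) where
    constructor reduce
    field
      numer denom : ℤ
      q*denom≡numer : q ℚ.* ℤ→ℚ denom ≡ ℤ→ℚ numer
      denom≉0 : ι denom ≉ 0#
      numer≈x*denom : ι numer ≈ x * ι denom

  ↦-cong : ∀ {q x y} → x ≈ y → q ↦ x → q ↦ y
  ↦-cong x≈y (reduce a b qb≡a b≉0 a≈xb) = reduce a b qb≡a b≉0 (trans a≈xb (*-congʳ x≈y))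

  ↦-ℤ : ∀ n → ℤ→ℚ n ↦ ι n
  ↦-ℤ n = reduce n (+ 1) (≡.trans (≡.sym (ℤ→ℚ-* n (+ 1))) (≡.cong ℤ→ℚ (ℤ.*-identityʳ n)))
    (small≉0 ℕ.z<s 1<p) (sym (trans (*-congˡ ι-1) (*-identityʳ _)))

  ι*-≉0 : ∀ {m n} → ι m ≉ 0# → ι n ≉ 0# → ι (m ℤ.* n) ≉ 0#
  ι*-≉0 m≉0 n≉0 mn≈0 = *-≉0 m≉0 n≉0 (trans (sym (ι-* _ _)) mn≈0)

  ↦-+ : ∀ {q r x y} → q ↦ x → r ↦ y → q ℚ.+ r ↦ x + y
  ↦-+ {q} {r} {x} {y} (reduce a b qb≡a b≉0 a≈xb) (reduce c d rd≡c d≉0 c≈yd) = reduce (a ℤ.* d ℤ.+ c ℤ.* b) (b ℤ.* d)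
    (begin
      (q ℚ.+ r) ℚ.* ℤ→ℚ (b ℤ.* d)                      ≡⟨ ≡.cong ((q ℚ.+ r) ℚ.*_) (ℤ→ℚ-* b d) ⟩
      (q ℚ.+ r) ℚ.* (ℤ→ℚ b ℚ.* ℤ→ℚ d)                  ≡⟨ ℚS.solve 4 (λ q r b d → (q ℚS.:+ r) ℚS.:* (b ℚS.:* d) ℚS.:=
                                                          q ℚS.:* b ℚS.:* d ℚS.:+ r ℚS.:* d ℚS.:* b) ≡.refl q r (ℤ→ℚ b) (ℤ→ℚ d) ⟩
      q ℚ.* ℤ→ℚ b ℚ.* ℤ→ℚ d ℚ.+ r ℚ.* ℤ→ℚ d ℚ.* ℤ→ℚ b  ≡⟨ ≡.cong₂ (λ u v → u ℚ.* ℤ→ℚ d ℚ.+ v ℚ.* ℤ→ℚ b) qb≡a rd≡c ⟩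
      ℤ→ℚ a ℚ.* ℤ→ℚ d ℚ.+ ℤ→ℚ c ℚ.* ℤ→ℚ b              ≡⟨ ≡.cong₂ ℚ._+_ (ℤ→ℚ-* a d) (ℤ→ℚ-* c b) ⟨
      ℤ→ℚ (a ℤ.* d) ℚ.+ ℤ→ℚ (c ℤ.* b)                  ≡⟨ ℤ→ℚ-+ (a ℤ.* d) (c ℤ.* b) ⟨
      ℤ→ℚ (a ℤ.* d ℤ.+ c ℤ.* b)                        ∎)
    (ι*-≉0 b≉0 d≉0)
    (trans (ι-+ _ _) (trans (+-cong (trans (ι-* a d) (*-congʳ a≈xb)) (trans (ι-* c b) (*-congʳ c≈yd)))
      (trans (solve 4 (λ x y b d → x :* b :* d :+ y :* d :* b := (x :+ y) :* (b :* d)) refl x y (ι b) (ι d))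
        (*-congˡ (sym (ι-* b d))))))
    where
    open ≡.≡-Reasoning
    module ℚS = ℚ.+-*-Solver

  ↦-* : ∀ {q r x y} → q ↦ x → r ↦ y → q ℚ.* r ↦ x * y
  ↦-* {q} {r} {x} {y} (reduce a b qb≡a b≉0 a≈xb) (reduce c d rd≡c d≉0 c≈yd) = reduce (a ℤ.* c) (b ℤ.* d)
    (begin
      (q ℚ.* r) ℚ.* ℤ→ℚ (b ℤ.* d)            ≡⟨ ≡.cong ((q ℚ.* r) ℚ.*_) (ℤ→ℚ-* b d) ⟩
      (q ℚ.* r) ℚ.* (ℤ→ℚ b ℚ.* ℤ→ℚ d)        ≡⟨ ℚS.solve 4 (λ q r b d → (q ℚS.:* r) ℚS.:* (b ℚS.:* d) ℚS.:=
                                                (q ℚS.:* b) ℚS.:* (r ℚS.:* d)) ≡.refl q r (ℤ→ℚ b) (ℤ→ℚ d) ⟩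
      (q ℚ.* ℤ→ℚ b) ℚ.* (r ℚ.* ℤ→ℚ d)        ≡⟨ ≡.cong₂ ℚ._*_ qb≡a rd≡c ⟩
      ℤ→ℚ a ℚ.* ℤ→ℚ c                        ≡⟨ ℤ→ℚ-* a c ⟨
      ℤ→ℚ (a ℤ.* c)                          ∎)
    (ι*-≉0 b≉0 d≉0)
    (trans (ι-* a c) (trans (*-cong a≈xb c≈yd)
      (trans (solve 4 (λ x y b d → (x :* b) :* (y :* d) := (x :* y) :* (b :* d)) refl x y (ι b) (ι d))
        (*-congˡ (sym (ι-* b d))))))
    where
    open ≡.≡-Reasoning
    module ℚS = ℚ.+-*-Solver

  ↦-neg : ∀ {q x} → q ↦ x → ℚ.- q ↦ - x
  ↦-neg {q} {x} (reduce a b qb≡a b≉0 a≈xb) = reduce (ℤ.- a) b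
    (≡.trans (≡.sym (ℚ.neg-distribˡ-* q (ℤ→ℚ b))) (≡.trans (≡.cong ℚ.-_ qb≡a) (≡.sym (ℤ→ℚ-neg a)))) b≉0
    (trans (ι-neg a) (trans (-‿cong a≈xb) (solve 2 (λ x b → :- (x :* b) := :- x :* b) refl x (ι b))))

  ↦-minus : ∀ {q r x y} → q ↦ x → r ↦ y → q ℚ.- r ↦ x - y
  ↦-minus q↦x r↦y = ↦-+ q↦x (↦-neg r↦y)

  ↦-^ : ∀ {q x} n → q ↦ x → q ^ℚ n ↦ x ^ n
  ↦-^ zero    q↦x = ↦-cong ι-1 (↦-ℤ (+ 1))
  ↦-^ (suc n) q↦x = ↦-* q↦x (↦-^ n q↦x)

  numerator-≈ : ∀ {q x} (q↦x : q ↦ x) →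
    ℚ.numerator q ℤ.* _↦_.denom q↦x ≡ _↦_.numer q↦x ℤ.* ℚ.denominator q
  numerator-≈ {q} (reduce a b qb≡a _ _) = ℤ→ℚ-injective (begin
    ℤ→ℚ (n ℤ.* b)               ≡⟨ ℤ→ℚ-* n b ⟩
    ℤ→ℚ n ℚ.* ℤ→ℚ b             ≡⟨ ≡.cong (ℚ._* ℤ→ℚ b) (*-denominator q) ⟨
    (q ℚ.* ℤ→ℚ d) ℚ.* ℤ→ℚ b     ≡⟨ ≡.trans (ℚ.*-assoc q (ℤ→ℚ d) (ℤ→ℚ b)) (≡.trans (≡.cong (q ℚ.*_) (ℚ.*-comm (ℤ→ℚ d) (ℤ→ℚ b)))
                                     (≡.sym (ℚ.*-assoc q (ℤ→ℚ b) (ℤ→ℚ d)))) ⟩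
    (q ℚ.* ℤ→ℚ b) ℚ.* ℤ→ℚ d     ≡⟨ ≡.cong (ℚ._* ℤ→ℚ d) qb≡a ⟩
    ℤ→ℚ a ℚ.* ℤ→ℚ d             ≡⟨ ℤ→ℚ-* a d ⟨
    ℤ→ℚ (a ℤ.* d)               ∎)
    where
    open ≡.≡-Reasoning
    n = ℚ.numerator q
    d = ℚ.denominator q

  private
    numerator-ι : ∀ {q x} (q↦x : q ↦ x) →
      ι (ℚ.numerator q) * ι (_↦_.denom q↦x) ≈ ι (_↦_.numer q↦x) * ι (ℚ.denominator q)
    numerator-ι q↦x = trans (sym (ι-* _ _)) (trans (ι-≡ (numerator-≈ q↦x)) (ι-* _ _))

  ↦0⇒∣ : ∀ {q x} → q ↦ x → x ≈ 0# → p ℕ.∣ ℤ.∣ ℚ.numerator q ∣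
  ↦0⇒∣ {q} q↦x@(reduce a b _ b≉0 a≈xb) x≈0 = ≈0⇒∣ (x*y≈0⇒x≈0 b≉0 (trans (numerator-ι q↦x)
    (trans (*-congʳ (trans a≈xb (trans (*-congʳ x≈0) (zeroˡ _)))) (zeroˡ _))))

  -- The fraction witnessing the reduction may differ from q in lowest terms. But if p divides the
  -- numerator of q, then it does not divide the denominator, so both fractions reduce to 0.
  ∣⇒↦0 : ∀ {q x} → q ↦ x → p ℕ.∣ ℤ.∣ ℚ.numerator q ∣ → x ≈ 0#
  ∣⇒↦0 {q} q↦x@(reduce a b _ b≉0 a≈xb) p∣n = x*y≈0⇒x≈0 b≉0 (trans (sym a≈xb) (x*y≈0⇒x≈0
    (λ d≈0 → ℕ.<-irrefl (≡.sym (lowestTerms q p∣n (≈0⇒∣ d≈0))) 1<p)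
    (trans (sym (numerator-ι q↦x)) (trans (*-congʳ (∣⇒≈0 p∣n)) (zeroˡ _)))))

  -- The witnessing fraction is turned upside down. The equation x y = 1 forces q to be nonzero, so
  -- `inv q` is the true inverse and not the default 0.
  ↦-inv : ∀ {q x y} → q ↦ x → x * y ≈ 1# → inv q ↦ y
  ↦-inv {q} {x} {y} q↦x@(reduce a b qb≡a b≉0 a≈xb) xy≈1 = reduce b a
    (begin
      inv q ℚ.* ℤ→ℚ a            ≡⟨ ≡.cong (inv q ℚ.*_) qb≡a ⟨
      inv q ℚ.* (q ℚ.* ℤ→ℚ b)    ≡⟨ ℚ.*-assoc (inv q) q (ℤ→ℚ b) ⟨
      (inv q ℚ.* q) ℚ.* ℤ→ℚ b    ≡⟨ ≡.cong (ℚ._* ℤ→ℚ b) (inv-inverseˡ q n≢0) ⟩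
      1ℚ ℚ.* ℤ→ℚ b               ≡⟨ ℚ.*-identityˡ (ℤ→ℚ b) ⟩
      ℤ→ℚ b                      ∎)
    (λ a≈0 → *-≉0 x≉0 b≉0 (trans (sym a≈xb) a≈0))
    (sym (trans (*-congˡ a≈xb) (trans (solve 3 (λ x y b → y :* (x :* b) := (x :* y) :* b) refl x y (ι b))
      (trans (*-congʳ xy≈1) (*-identityˡ _)))))
    where
    open ≡.≡-Reasoning
    x≉0 : x ≉ 0#
    x≉0 x≈0 = small≉0 ℕ.z<s 1<p (trans ι-1 (trans (sym xy≈1) (trans (*-congʳ x≈0) (zeroˡ _))))
    n≢0 : ℚ.numerator q ≢ + 0
    n≢0 n≡0 = x≉0 (∣⇒↦0 q↦x (≡.subst (λ n → p ℕ.∣ ℤ.∣ n ∣) (≡.sym n≡0) (p ℕ.∣0)))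

  ↦-sumTo : ∀ n {f g} → (∀ k → f k ↦ g k) → sumTo n f ↦ ∑ n g
  ↦-sumTo n {f} {g} f↦g = ≡.subst (λ l → List.foldr ℚ._+_ 0ℚ l ↦ ∑ n g) (≡.sym (List.map-upTo f (suc n))) (go n f↦g)
    where
    go : ∀ n {f g} → (∀ k → f k ↦ g k) → List.foldr ℚ._+_ 0ℚ (applyUpTo f (suc n)) ↦ ∑ n g
    go zero    {f} {g} f↦g = ↦-cong (trans (+-congˡ ι-0) (+-identityʳ _)) (↦-+ (f↦g 0) (↦-ℤ (+ 0)))
    go (suc n) {f} {g} f↦g = ↦-cong (sym (∑-head n g)) (↦-+ (f↦g 0) (go n (λ k → f↦g (suc k))))

  -- The inverse is n^(p-2). It is given as an integer, so that its powers can be absorbed into the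
  -- integer coefficients `α` and `β`.
  ι-inverse : ∀ {n} → ι n ≉ 0# → ∃ λ m → ι (n ℤ.* m) ≈ 1#
  ι-inverse {n} n≉0 = go p ≡.refl
    where
    go : ∀ k → k ≡ p → ∃ λ m → ι (n ℤ.* m) ≈ 1#
    go zero          ≡.refl = ⊥-elim (ℕ.<-irrefl ≡.refl 0<p)
    go (suc zero)    ≡.refl = ⊥-elim (ℕ.<-irrefl ≡.refl 1<p)
    go (suc (suc k)) eq     = n ℤ.^ k , trans (ι-^ n (suc k)) (fermat′ eq n≉0)

  reducible : ∀ q → InZp p q → ∃ λ x → q ↦ x
  reducible q p∤d = ι (n ℤ.* m) , reduce n d (*-denominator q) d≉0 (begin
    ι n                     ≈⟨ trans (*-congˡ (proj₂ d⁻¹)) (*-identityʳ _) ⟨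
    ι n * ι (d ℤ.* m)       ≈⟨ *-congˡ (ι-* d m) ⟩
    ι n * (ι d * ι m)       ≈⟨ solve 3 (λ n d m → n :* (d :* m) := (n :* m) :* d) refl _ _ _ ⟩
    (ι n * ι m) * ι d       ≈⟨ *-congʳ (ι-* n m) ⟨
    ι (n ℤ.* m) * ι d       ∎)
    where
    open Reasoning
    n = ℚ.numerator q
    d = ℚ.denominator q
    d≉0 : ι d ≉ 0#
    d≉0 d≈0 = p∤d (≈0⇒∣ d≈0)
    d⁻¹ = ι-inverse d≉0
    m = proj₁ d⁻¹

-- The residue of p modulo 6

record HalfAndSixth (p : ℕ) : Set where
  field
    p≡2h+1 : p ≡ suc ((p ℕ.∸ 1) ℕ./ 2 ℕ.+ (p ℕ.∸ 1) ℕ./ 2)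
    3n≤h   : 3 ℕ.* (p ℕ./ 6) ℕ.≤ (p ℕ.∸ 1) ℕ./ 2
    p≡±1   : 1 ℕ.+ 6 ℕ.* (p ℕ./ 6) ≡ p ⊎ 5 ℕ.+ 6 ℕ.* (p ℕ./ 6) ≡ p

-- A prime above 3 is 6n + 1 or 6n + 5, so h is 3n or 3n + 2. The two values of p are the outer
-- factors of `r₂ n`, which is why the second sum ends at ⌊p/6⌋ in both cases.
halfAndSixth : ∀ p → Prime p → 3 ℕ.< p → HalfAndSixth p
halfAndSixth p p-prime 3<p = go (p ℕ.% 6) (ℕ.m%n<n p 6) (≡.trans (ℕ.m≡m%n+[m/n]*n p 6) (≡.cong (p ℕ.% 6 ℕ.+_) (ℕ.*-comm (p ℕ./ 6) 6)))
  where
  n = p ℕ./ 6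
  open ℕ.+-*-Solver
  indivisible : ∀ {d} m → 1 ℕ.< d → d ℕ.< p → p ≢ d ℕ.* m
  indivisible {d} m 1<d d<p p≡dm with prime⇒irreducible p-prime (ℕ.divides m (≡.trans p≡dm (ℕ.*-comm d m)))
  ... | inj₁ d≡1 = ℕ.<-irrefl (≡.sym d≡1) 1<d
  ... | inj₂ d≡p = ℕ.<-irrefl d≡p d<p
  2<p = ℕ.<-trans (ℕ.n<1+n 2) 3<p
  build : ∀ h → p ≡ suc (h ℕ.+ h) → 3 ℕ.* n ℕ.≤ h → 1 ℕ.+ 6 ℕ.* n ≡ p ⊎ 5 ℕ.+ 6 ℕ.* n ≡ p → HalfAndSixth p
  build h p≡ 3n≤h p≡±1 = record
    { p≡2h+1 = ≡.trans p≡ (≡.cong (λ m → suc (m ℕ.+ m)) h≡)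
    ; 3n≤h   = ≡.subst (3 ℕ.* n ℕ.≤_) h≡ 3n≤h
    ; p≡±1   = p≡±1
    }
    where
    h≡ : h ≡ (p ℕ.∸ 1) ℕ./ 2
    h≡ = ≡.trans (≡.sym (ℕ.m*n/n≡m h 2)) (≡.cong (λ m → m ℕ./ 2)
      (≡.trans (solve 1 (λ h → h :* con 2 := h :+ h) ≡.refl h) (≡.cong (ℕ._∸ 1) (≡.sym p≡))))
  go : ∀ r → r ℕ.< 6 → p ≡ r ℕ.+ 6 ℕ.* n → HalfAndSixth p
  go 0 _ eq = ⊥-elim (indivisible (3 ℕ.* n) (ℕ.n<1+n 1) 2<p
    (≡.trans eq (solve 1 (λ n → con 6 :* n := con 2 :* (con 3 :* n)) ≡.refl n)))
  go 1 _ eq = build (3 ℕ.* n) (≡.trans eq (solve 1 (λ n → con 1 :+ con 6 :* n := con 1 :+ (con 3 :* n :+ con 3 :* n)) ≡.refl n))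
    ℕ.≤-refl (inj₁ (≡.sym eq))
  go 2 _ eq = ⊥-elim (indivisible (1 ℕ.+ 3 ℕ.* n) (ℕ.n<1+n 1) 2<p
    (≡.trans eq (solve 1 (λ n → con 2 :+ con 6 :* n := con 2 :* (con 1 :+ con 3 :* n)) ≡.refl n)))
  go 3 _ eq = ⊥-elim (indivisible (1 ℕ.+ 2 ℕ.* n) (ℕ.s<s ℕ.z<s) 3<p
    (≡.trans eq (solve 1 (λ n → con 3 :+ con 6 :* n := con 3 :* (con 1 :+ con 2 :* n)) ≡.refl n)))
  go 4 _ eq = ⊥-elim (indivisible (2 ℕ.+ 3 ℕ.* n) (ℕ.n<1+n 1) 2<p
    (≡.trans eq (solve 1 (λ n → con 4 :+ con 6 :* n := con 2 :* (con 2 :+ con 3 :* n)) ≡.refl n)))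
  go 5 _ eq = build (2 ℕ.+ 3 ℕ.* n) (≡.trans eq (solve 1 (λ n → con 5 :+ con 6 :* n :=
      con 1 :+ ((con 2 :+ con 3 :* n) :+ (con 2 :+ con 3 :* n))) ≡.refl n))
    (ℕ.m≤n+m (3 ℕ.* n) 2) (inj₂ (≡.sym eq))
  go (suc (suc (suc (suc (suc (suc r)))))) (ℕ.s<s (ℕ.s<s (ℕ.s<s (ℕ.s<s (ℕ.s<s (ℕ.s<s ())))))) _

-- From the polynomial identity to the congruences

module Congruences {c ℓ} (K : CommutativeRing c ℓ) (int : IntegersTo K) (p : ℕ) (p-prime : Prime p)
  (domain : IsDomainOfCharacteristic p K int) (3<p : 3 ℕ.< p) where
  open Characteristic K int p p-prime domain
  open Reduction K int p p-prime domain
  open Transformation K int p p-prime domain 3<p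
  open HalfAndSixth (halfAndSixth p p-prime 3<p)
  open Reasoning

  h n : ℕ
  h = (p ℕ.∸ 1) ℕ./ 2
  n = p ℕ./ 6

  108≉0 : ι (+ 108) ≉ 0#
  108≉0 = ι*-≉0 {+ 4} {+ 27} (ι*-≉0 {+ 2} {+ 2} 2≉0 2≉0) (ι*-≉0 {+ 3} {+ 9} 3≉0 (ι*-≉0 {+ 3} {+ 3} 3≉0 3≉0))

  432≉0 : ι (+ 432) ≉ 0#
  432≉0 = ι*-≉0 {+ 4} {+ 108} (ι*-≉0 {+ 2} {+ 2} 2≉0 2≉0) 108≉0

  u v : ℤ
  u = proj₁ (ι-inverse 108≉0)
  v = proj₁ (ι-inverse 432≉0)

  108u≈1 : ι (+ 108 ℤ.* u) ≈ 1#
  108u≈1 = proj₂ (ι-inverse 108≉0)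

  432v≈1 : ι (+ 432 ℤ.* v) ≈ 1#
  432v≈1 = proj₂ (ι-inverse 432≉0)

  r₂n≈0 : ι (r₂ n) ≈ 0#
  r₂n≈0 = trans (ι-≡ (affine³-pos 1 6 1 2 5 6 n)) (∣⇒≈0 (p∣ p≡±1))
    where
    p∣ : 1 ℕ.+ 6 ℕ.* n ≡ p ⊎ 5 ℕ.+ 6 ℕ.* n ≡ p → p ℕ.∣ (1 ℕ.+ 6 ℕ.* n) ℕ.* ((1 ℕ.+ 2 ℕ.* n) ℕ.* (5 ℕ.+ 6 ℕ.* n))
    p∣ (inj₁ eq) = ℕ.∣m⇒∣m*n _ (ℕ.∣-reflexive (≡.sym eq))
    p∣ (inj₂ eq) = ℕ.∣n⇒∣m*n (1 ℕ.+ 6 ℕ.* n) (ℕ.∣n⇒∣m*n (1 ℕ.+ 2 ℕ.* n) (ℕ.∣-reflexive (≡.sym eq)))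

  cube : Carrier → Carrier
  cube x = x * (x * x)

  Σ₁ Σ₂ : Carrier → Carrier
  Σ₁ x = ∑ h (λ k → ι (+ A k) * x ^ k)
  Σ₂ x = ∑ n (λ k → ι (+ B k) * x ^ k)

  -- The transformation at x = 1 - r: then 1 - r² = x(2-x), 1 + r = 2 - x and 5 - 4r = 1 + 4x.
  Σ₁≈fʰΣ₂ : ∀ r e → let f = ι (+ 5) - ι (+ 4) * r in f * e ≈ 1# →
    Σ₁ ((ι (+ 1) - r * r) * ι u) ≈
    f ^ h * Σ₂ (ι v * ((ι (+ 1) - r) * cube (ι (+ 1) + r)) * cube e)
  Σ₁≈fʰΣ₂ r e fe≈1 = begin
    Σ₁ ((ι (+ 1) - r * r) * ι u)
      ≈⟨ ∑-cong h (λ k _ → left k) ⟩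
    _ ≈⟨ transformation h p≡2h+1 u v 108u≈1 432v≈1 n 3n≤h r₂n≈0 x ⟩
    _ ≈⟨ ∑-cong n right ⟨
    ∑ n (λ k → f ^ h * (ι (+ B k) * y ^ k))
      ≈⟨ ∑-distribˡ n (f ^ h) _ ⟨
    f ^ h * Σ₂ y ∎
    where
    f = ι (+ 5) - ι (+ 4) * r
    x = ι (+ 1) - r
    y = ι v * ((ι (+ 1) - r) * cube (ι (+ 1) + r)) * cube e
    x₂ = ι (+ 2) - x
    f′ = ι (+ 1) + ι (+ 4) * x
    left : ∀ k → ι (+ A k) * ((ι (+ 1) - r * r) * ι u) ^ k ≈ ι (+ A k ℤ.* u ℤ.^ k) * (x * x₂) ^ k
    left k = begin
      ι (+ A k) * ((ι (+ 1) - r * r) * ι u) ^ k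
        ≈⟨ *-congˡ (trans (^-congˡ k (solve 2 (λ r u → (con (+ 1) :- r :* r) :* u :=
             u :* ((con (+ 1) :- r) :* (con (+ 2) :- (con (+ 1) :- r)))) refl r (ι u))) (^-distrib-* _ _ k)) ⟩
      ι (+ A k) * (ι u ^ k * (x * x₂) ^ k)
        ≈⟨ *-assoc _ _ _ ⟨
      ι (+ A k) * ι u ^ k * (x * x₂) ^ k
        ≈⟨ *-congʳ (trans (ι-* _ _) (*-congˡ (ι-^ u k))) ⟨
      ι (+ A k ℤ.* u ℤ.^ k) * (x * x₂) ^ k ∎
    right : ∀ k → k ℕ.≤ n → f ^ h * (ι (+ B k) * y ^ k) ≈
      ι (+ B k ℤ.* v ℤ.^ k) * ((x * cube x₂) ^ k * f′ ^ (h ℕ.∸ 3 ℕ.* k))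
    right k k≤n = begin
      f ^ h * (ι (+ B k) * y ^ k)
        -- Of fʰ, the part f³ᵏ clears the denominators e³ᵏ in yᵏ, and fʰ⁻³ᵏ is left over; this needs
        -- 3k ≤ h.
        ≈⟨ *-congʳ (trans (reflexive (≡.cong (f ^_) (≡.sym (ℕ.m+[n∸m]≡n 3k≤h)))) (^-homo-* f (3 ℕ.* k) j)) ⟩
      f ^ (3 ℕ.* k) * f ^ j * (ι (+ B k) * y ^ k)
        ≈⟨ solve 4 (λ a b c d → a :* b :* (c :* d) := c :* (d :* a :* b)) refl _ _ _ _ ⟩
      ι (+ B k) * (y ^ k * f ^ (3 ℕ.* k) * f ^ j)
        ≈⟨ *-congˡ (*-cong (trans (*-congˡ (sym (^-assocʳ f 3 k))) (sym (^-distrib-* y (f ^ 3) k))) (^-congˡ j f≈f′)) ⟩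
      ι (+ B k) * ((y * f ^ 3) ^ k * f′ ^ j)
        ≈⟨ *-congˡ (*-congʳ (trans (^-congˡ k yf³) (^-distrib-* _ _ k))) ⟩
      ι (+ B k) * (ι v ^ k * (x * cube x₂) ^ k * f′ ^ j)
        ≈⟨ solve 4 (λ a b c d → a :* (b :* c :* d) := a :* b :* (c :* d)) refl _ _ _ _ ⟩
      ι (+ B k) * ι v ^ k * ((x * cube x₂) ^ k * f′ ^ j)
        ≈⟨ *-congʳ (trans (ι-* _ _) (*-congˡ (ι-^ v k))) ⟨
      ι (+ B k ℤ.* v ℤ.^ k) * ((x * cube x₂) ^ k * f′ ^ j) ∎
      where
      j = h ℕ.∸ 3 ℕ.* k
      3k≤h : 3 ℕ.* k ℕ.≤ h
      3k≤h = ℕ.≤-trans (ℕ.*-monoʳ-≤ 3 k≤n) 3n≤h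
      f≈f′ : f ≈ f′
      f≈f′ = solve 1 (λ r → con (+ 5) :- con (+ 4) :* r := con (+ 1) :+ con (+ 4) :* (con (+ 1) :- r)) refl r
      yf³ : y * f ^ 3 ≈ ι v * (x * cube x₂)
      yf³ = begin
        y * (f * (f * (f * 1#)))
          -- The variable o is the `1#` that ends `f ^ 3`; the solver knows only `ι (+ 1)` as a
          -- constant.
          ≈⟨ solve 5 (λ v r e f o → let w = con (+ 1) :+ r in
               v :* ((con (+ 1) :- r) :* (w :* (w :* w))) :* (e :* (e :* e)) :* (f :* (f :* (f :* o))) :=
               (let w′ = con (+ 2) :- (con (+ 1) :- r) in
               v :* ((con (+ 1) :- r) :* (w′ :* (w′ :* w′))) :* ((f :* e) :* ((f :* e) :* (f :* e)) :* o)))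
               refl (ι v) r e f 1# ⟩
        ι v * (x * cube x₂) * ((f * e) * ((f * e) * (f * e)) * 1#)
          ≈⟨ *-congˡ (trans (*-identityʳ _) (*-cong fe≈1 (*-cong fe≈1 fe≈1))) ⟩
        ι v * (x * cube x₂) * (1# * (1# * 1#))
          ≈⟨ trans (*-congˡ (trans (*-identityˡ _) (*-identityˡ _))) (*-identityʳ _) ⟩
        ι v * (x * cube x₂) ∎

  -- Unlike the value given by `↦-^`, this one ends in `ι (+ 1)`, which the ring solver reads as a
  -- constant.
  ↦-cube : ∀ {q x} → q ↦ x → q ^ℚ 3 ↦ x * (x * (x * ι (+ 1)))
  ↦-cube q↦x = ↦-* q↦x (↦-* q↦x (↦-* q↦x (↦-ℤ (+ 1))))

  ↦-scaled-cube-inv : ∀ {q f e} → q ↦ f → f * e ≈ 1# → inv (ℕ→ℚ 432 ℚ.* (q ^ℚ 3)) ↦ ι v * cube e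
  ↦-scaled-cube-inv {q} {f} {e} q↦f fe≈1 = ↦-inv (↦-* (↦-ℤ (+ 432)) (↦-^ 3 q↦f)) (begin
    ι (+ 432) * (f * (f * (f * 1#))) * (ι v * cube e)
      ≈⟨ solve 5 (λ a v f e o → a :* (f :* (f :* (f :* o))) :* (v :* (e :* (e :* e))) :=
           (a :* v) :* (((f :* e) :* ((f :* e) :* (f :* e))) :* o)) refl (ι (+ 432)) (ι v) f e 1# ⟩
    (ι (+ 432) * ι v) * (((f * e) * ((f * e) * (f * e))) * 1#)
      ≈⟨ *-cong (trans (sym (ι-* _ _)) 432v≈1) (*-congʳ (*-cong fe≈1 (*-cong fe≈1 fe≈1))) ⟩
    1# * ((1# * (1# * 1#)) * 1#)
      ≈⟨ trans (*-identityˡ _) (trans (*-identityʳ _) (trans (*-identityˡ _) (*-identityˡ _))) ⟩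
    1# ∎)

  module _ {t : ℚ} {r : Carrier} (t↦r : t ↦ r) where

    S₁-↦ : S₁ p t ↦ Σ₁ ((ι (+ 1) - r * r) * ι u)
    S₁-↦ = ↦-sumTo h λ k → ↦-* (↦-ℤ (+ A k)) (↦-^ k
      (↦-* (↦-minus (↦-ℤ (+ 1)) (↦-* t↦r t↦r)) (↦-inv (↦-ℤ (+ 108)) (trans (sym (ι-* _ _)) 108u≈1))))

    -- The denominator involves 4t - 5 = -(5 - 4t), whose inverse reduces to -e; the sign of its
    -- cube is absorbed by (t - 1) = -(1 - t).
    S₂-↦ : ∀ e → (ι (+ 5) - ι (+ 4) * r) * e ≈ 1# →
      S₂ p t ↦ Σ₂ (ι v * ((ι (+ 1) - r) * cube (ι (+ 1) + r)) * cube e)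
    S₂-↦ e fe≈1 = ↦-sumTo n λ k → ↦-* (↦-ℤ (+ B k)) (↦-^ k (↦-cong
      (solve 3 (λ r v e → let w = r :+ con (+ 1) ; w′ = con (+ 1) :+ r ; d = :- e in
         (r :- con (+ 1)) :* (w :* (w :* (w :* con (+ 1)))) :* (v :* (d :* (d :* d))) :=
         v :* ((con (+ 1) :- r) :* (w′ :* (w′ :* w′))) :* (e :* (e :* e))) refl r (ι v) e)
      (↦-* (↦-* (↦-minus t↦r (↦-ℤ (+ 1))) (↦-cube (↦-+ t↦r (↦-ℤ (+ 1)))))
        (↦-scaled-cube-inv (↦-minus (↦-* (↦-ℤ (+ 4)) t↦r) (↦-ℤ (+ 5)))
          (trans (solve 2 (λ r e → (con (+ 4) :* r :- con (+ 5)) :* (:- e) := (con (+ 5) :- con (+ 4) :* r) :* e)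
            refl r e) fe≈1)))))

    S₃-↦ : ∀ e → (ι (+ 5) - ι (+ 4) * (- r)) * e ≈ 1# →
      S₃ p t ↦ Σ₂ (ι v * ((ι (+ 1) - (- r)) * cube (ι (+ 1) + - r)) * cube e)
    S₃-↦ e fe≈1 = ↦-sumTo n λ k → ↦-* (↦-ℤ (+ B k)) (↦-^ k (↦-cong
      (solve 3 (λ r v e → let w = con (+ 1) :- r ; w′ = con (+ 1) :+ :- r in
         (r :+ con (+ 1)) :* (w :* (w :* (w :* con (+ 1)))) :* (v :* (e :* (e :* e))) :=
         v :* ((con (+ 1) :- (:- r)) :* (w′ :* (w′ :* w′))) :* (e :* (e :* e))) refl r (ι v) e)
      (↦-* (↦-* (↦-+ t↦r (↦-ℤ (+ 1))) (↦-cube (↦-minus (↦-ℤ (+ 1)) t↦r)))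
        (↦-scaled-cube-inv (↦-+ (↦-* (↦-ℤ (+ 4)) t↦r) (↦-ℤ (+ 5)))
          (trans (solve 2 (λ r e → (con (+ 4) :* r :+ con (+ 5)) :* e := (con (+ 5) :- con (+ 4) :* (:- r)) :* e)
            refl r e) fe≈1)))))

  ≡mod⇒≈ : ∀ {q r x y} → q ↦ x → r ↦ y → q ≡ r [mod p ] → x ≈ y
  ≡mod⇒≈ q↦x r↦y q≡r = x∙y⁻¹≈ε⇒x≈y _ _ (∣⇒↦0 (↦-minus q↦x r↦y) q≡r)

  ≈⇒≡mod : ∀ {q r x y} → q ↦ x → r ↦ y → x ≈ y → q ≡ r [mod p ]
  ≈⇒≡mod q↦x r↦y x≈y = ↦0⇒∣ (↦-minus q↦x r↦y) (x≈y⇒x∙y⁻¹≈ε x≈y)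

  -- An integer representative a of 5 - 4r serves twice: its inverse modulo p provides e, and
  -- Euler's criterion turns its power aʰ into the Legendre symbol.
  legendre-transformation : ∀ .{{_ : ℕ.NonZero p}} a r → ι a ≈ ι (+ 5) - ι (+ 4) * r → ι a ≉ 0# →
    ∃ λ e → (ι (+ 5) - ι (+ 4) * r) * e ≈ 1# ×
      Σ₁ ((ι (+ 1) - r * r) * ι u) ≈
      ι (legendre p a) * Σ₂ (ι v * ((ι (+ 1) - r) * cube (ι (+ 1) + r)) * cube e)
  legendre-transformation a r a≈f a≉0 = e , fe≈1 , trans (Σ₁≈fʰΣ₂ r e fe≈1)
    (*-congʳ (trans (^-congˡ h (sym a≈f)) (sym (euler h p≡2h+1 a))))
    where
    e = ι (proj₁ (ι-inverse a≉0))
    fe≈1 : (ι (+ 5) - ι (+ 4) * r) * e ≈ 1#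
    fe≈1 = trans (*-congʳ (sym a≈f)) (trans (sym (ι-* _ _)) (proj₂ (ι-inverse a≉0)))

  congruences : .{{_ : ℕ.NonZero p}} → (t : ℚ) → InZp p t →
    ¬ ((ℕ→ℚ 4 ℚ.* t) ≡ ℕ→ℚ 5 [mod p ]) →
    ¬ ((ℕ→ℚ 4 ℚ.* t) ≡ ℚ.- ℕ→ℚ 5 [mod p ]) →
    (a b : ℤ) → ℤ→ℚ a ≡ ℕ→ℚ 5 ℚ.- ℕ→ℚ 4 ℚ.* t [mod p ] →
    ℤ→ℚ b ≡ ℕ→ℚ 5 ℚ.+ ℕ→ℚ 4 ℚ.* t [mod p ] →
    (S₁ p t ≡ ℤ→ℚ (legendre p a) ℚ.* S₂ p t [mod p ])
    × (ℤ→ℚ (legendre p a) ℚ.* S₂ p t ≡ ℤ→ℚ (legendre p b) ℚ.* S₃ p t [mod p ])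
  congruences t t∈Zp 4t≢5 4t≢-5 a b a≡5-4t b≡5+4t =
    ≈⇒≡mod (S₁-↦ t↦r) aS₂↦ eqₐ , ≈⇒≡mod aS₂↦ bS₃↦ (trans (sym eqₐ) (trans Σ₁-even eq_b))
    where
    r = proj₁ (reducible t t∈Zp)
    t↦r = proj₂ (reducible t t∈Zp)
    4t↦ : ℕ→ℚ 4 ℚ.* t ↦ ι (+ 4) * r
    4t↦ = ↦-* (↦-ℤ (+ 4)) t↦r
    a≈ : ι a ≈ ι (+ 5) - ι (+ 4) * r
    a≈ = ≡mod⇒≈ (↦-ℤ a) (↦-minus (↦-ℤ (+ 5)) 4t↦) a≡5-4t
    b≈ : ι b ≈ ι (+ 5) - ι (+ 4) * (- r)
    b≈ = trans (≡mod⇒≈ (↦-ℤ b) (↦-+ (↦-ℤ (+ 5)) 4t↦) b≡5+4t)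
      (solve 1 (λ r → con (+ 5) :+ con (+ 4) :* r := con (+ 5) :- con (+ 4) :* (:- r)) refl r)
    a≉0 : ι a ≉ 0#
    a≉0 a≈0 = 4t≢5 (≈⇒≡mod 4t↦ (↦-ℤ (+ 5)) (sym (x∙y⁻¹≈ε⇒x≈y _ _ (trans (sym a≈) a≈0))))
    b≉0 : ι b ≉ 0#
    b≉0 b≈0 = 4t≢-5 (≈⇒≡mod 4t↦ (↦-neg (↦-ℤ (+ 5))) (x∙y⁻¹≈ε⇒x≈y _ _ (trans
      (solve 1 (λ r → con (+ 4) :* r :- (:- con (+ 5)) := con (+ 5) :- con (+ 4) :* (:- r)) refl r)
      (trans (sym b≈) b≈0))))
    tₐ = legendre-transformation a r a≈ a≉0
    t_b = legendre-transformation b (- r) b≈ b≉0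
    eqₐ = proj₂ (proj₂ tₐ)
    eq_b = proj₂ (proj₂ t_b)
    aS₂↦ = ↦-* (↦-ℤ (legendre p a)) (S₂-↦ t↦r (proj₁ tₐ) (proj₁ (proj₂ tₐ)))
    bS₃↦ = ↦-* (↦-ℤ (legendre p b)) (S₃-↦ t↦r (proj₁ t_b) (proj₁ (proj₂ t_b)))
    Σ₁-even : Σ₁ ((ι (+ 1) - r * r) * ι u) ≈ Σ₁ ((ι (+ 1) - (- r) * (- r)) * ι u)
    Σ₁-even = ∑-cong h λ k _ → *-congˡ (^-congˡ k
      (solve 2 (λ r u → (con (+ 1) :- r :* r) :* u := (con (+ 1) :- (:- r) :* (:- r)) :* u) refl r (ι u)))

isDomain : ∀ p → Prime p → IsDomainOfCharacteristic p (Modular.commutativeRing p) (Modular.integers p)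
isDomain p p-prime = record { ∣⇒≈0 = ∣⇒≈0 ; ≈0⇒∣ = ≈0⇒∣ ; integral = integral }
  where
  open Modular p
  ∣⇒≈0 : ∀ {n} → p ℕ.∣ ℤ.∣ n ∣ → n ≈ₚ + 0
  ∣⇒≈0 {n} p∣n = congruent (≡.subst (+ p ℤ.∣_) (≡.sym (ℤ.+-identityʳ n)) (ℤ.∣ᵤ⇒∣ p∣n))
  ≈0⇒∣ : ∀ {n} → n ≈ₚ + 0 → p ℕ.∣ ℤ.∣ n ∣
  ≈0⇒∣ {n} n≈0 = ≡.subst (λ m → p ℕ.∣ ℤ.∣ m ∣) (ℤ.+-identityʳ n) (ℤ.∣⇒∣ᵤ (difference n≈0))
  integral : ∀ {m n} → m ℤ.* n ≈ₚ + 0 → m ≈ₚ + 0 ⊎ n ≈ₚ + 0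
  integral {m} {n} mn≈0 with euclidsLemma ℤ.∣ m ∣ ℤ.∣ n ∣ p-prime (≡.subst (p ℕ.∣_) (ℤ.abs-* m n) (≈0⇒∣ mn≈0))
  ... | inj₁ p∣m = inj₁ (∣⇒≈0 p∣m)
  ... | inj₂ p∣n = inj₂ (∣⇒≈0 p∣n)

open import Data.Rational using (_*_; _+_; _-_; -_)

theorem2p2 : (p : ℕ) → .{{_ : NonZero p}} → Prime p → 3 < p →
    (t : ℚ) → InZp p t →
    ¬ ((ℕ→ℚ 4 * t) ≡ ℕ→ℚ 5 [mod p ]) →
    ¬ ((ℕ→ℚ 4 * t) ≡ - ℕ→ℚ 5 [mod p ]) →
    (a b : ℤ) → ℤ→ℚ a ≡ ℕ→ℚ 5 - ℕ→ℚ 4 * t [mod p ] →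
    ℤ→ℚ b ≡ ℕ→ℚ 5 + ℕ→ℚ 4 * t [mod p ] →
    (S₁ p t ≡ ℤ→ℚ (legendre p a) * S₂ p t [mod p ])
    × (ℤ→ℚ (legendre p a) * S₂ p t ≡ ℤ→ℚ (legendre p b) * S₃ p t [mod p ])
theorem2p2 p p-prime 3<p =
  Congruences.congruences (Modular.commutativeRing p) (Modular.integers p) p p-prime (isDomain p p-prime) 3<p
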